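{- Let $r\ge1$, $(k_1,\dots,k_r)\in\mathbb{Z}_{\ge1}^r$ and $t\in\mathbb{Z}_{\ge0}$. Then \[ \sum_{\substack{m_1+\cdots+m_r=r+t\\ m_i\ge1\,(1\le i\le r)}}\ \sum_{\substack{\mathbf{a}_i\in\mathbb{Z}_{\ge1}^{m_i},\ |\mathbf{a}_i|=k_i+m_i-1\\(1\le i\le r)}}\zeta^+(\mathbf{a}_1,\dots,\mathbf{a}_r) =\sum_{l=0}^{t}\ \sum_{\substack{m_1+\cdots+m_{r-1}=t-l\\ m_i\ge0\,(1\le i\le r-1)}}\ \sum_{\substack{|\mathbf{e}|=l\\ \mathbf{e}\ge0}}\zeta^+\big((k_1,\{1\}^{m_1},\dots,k_{r-1},\{1\}^{m_{r-1}},k_r)+\mathbf{e}\big), \] where $(\mathbf{a}_1,\dots,\mathbf{a}_r)$ denotes the concatenation of the tuples, and in the last sum $\mathbf{e}$ ranges over tuples of non-negative integers of the same depth as $(k_1,\{1\}^{m_1},\dots,k_{r-1},\{1\}^{m_{r-1}},k_r)$ with sum $l$. When $r=1$, the right-hand side is understood as $\zeta^+(k_1+t)$.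
   Context: For positive integers $k_1,\dots,k_r$ with $k_1\ge2$, the multiple zeta value is $\zeta(k_1,\dots,k_r)=\sum_{n_1>\cdots>n_r\ge1}n_1^{ -k_1}\cdots n_r^{ -k_r}$. For $(k_1,\dots,k_r)\in\mathbb{Z}_{\ge1}^r$ set $\zeta^+(k_1,\dots,k_r):=\zeta(k_1+1,k_2,\dots,k_r)$. An index is a finite tuple of positive integers; for an index $\mathbf{k}=(k_1,\dots,k_r)$, its weight is $|\mathbf{k}|=k_1+\cdots+k_r$ and its depth is $r$. For two tuples of the same depth, $\mathbf{k}+\mathbf{e}$ denotes componentwise addition; $\mathbf{e}\ge0$ means every component of $\mathbf{e}$ is a non-negative integer, and $|\mathbf{e}|$ is the sum of its components. $\{1\}^m$ denotes $m$ consecutive entries equal to $1$ (empty if $m=0$). -}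

module Defs where

open import Data.Nat as ℕ using (ℕ; zero; suc; _∸_)
open import Data.List using (List; []; _∷_; _++_; map; concatMap; upTo; replicate; zipWith; length)
open import Data.Integer using (+_)
open import Data.Rational using (ℚ; _/_; _+_; _*_; 0ℚ; 1ℚ)

invPow : ℕ → ℕ → ℚ
invPow m zero    = 1ℚ
invPow m (suc k) = ((+ 1) / suc m) * invPow m k

sumℚ : List ℚ → ℚ
sumℚ []       = 0ℚ
sumℚ (x ∷ xs) = x + sumℚ xs

-- Truncated multiple zeta sum:
-- zetaTr N (k₁,…,k_r) = Σ_{N > n₁ > ⋯ > n_r ≥ 1} n₁^{-k₁} ⋯ n_r^{-k_r}
zetaTr : ℕ → List ℕ → ℚ
zetaTr N []       = 1ℚ
zetaTr N (k ∷ ks) = sumℚ (map (λ m → invPow m k * zetaTr (suc m) ks) (upTo (N ∸ 1)))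

-- Truncation of ζ⁺(k₁,…,k_r) = ζ(k₁+1,k₂,…,k_r)
incrFirst : List ℕ → List ℕ
incrFirst []       = []
incrFirst (k ∷ ks) = suc k ∷ ks

zetaPlusTr : ℕ → List ℕ → ℚ
zetaPlusTr N ks = zetaTr N (incrFirst ks)

weakComps : ℕ → ℕ → List (List ℕ)
weakComps zero    zero    = [] ∷ []
weakComps zero    (suc n) = []
weakComps (suc r) n = concatMap (λ j → map (j ∷_) (weakComps r (n ∸ j))) (upTo (suc n))

posComps : ℕ → ℕ → List (List ℕ)
posComps zero    zero    = [] ∷ []
posComps zero    (suc w) = []
posComps (suc m) w = concatMap (λ j → map (suc j ∷_) (posComps m (w ∸ suc j))) (upTo w)

concatChoices : List (List (List ℕ)) → List (List ℕ)
concatChoices []         = [] ∷ []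
concatChoices (xs ∷ xss) = concatMap (λ a → map (a ++_) (concatChoices xss)) xs

interleave : List ℕ → List ℕ → List ℕ
interleave []       ms       = []
interleave (k ∷ ks) []       = k ∷ interleave ks []
interleave (k ∷ ks) (m ∷ ms) = k ∷ (replicate m 1 ++ interleave ks ms)

lhsTr : List ℕ → ℕ → ℕ → ℚ
lhsTr ks t N =
  sumℚ (map (λ ms →
    sumℚ (map (zetaPlusTr N)
      (concatChoices (zipWith (λ k m → posComps m (k ℕ.+ m ∸ 1)) ks ms))))
  (posComps (length ks) (length ks ℕ.+ t)))

rhsTr : List ℕ → ℕ → ℕ → ℚ
rhsTr ks t N =
  sumℚ (map (λ l →
    sumℚ (map (λ ms →
      let idx = interleave ks ms in
      sumℚ (map (λ e → zetaPlusTr N (zipWith ℕ._+_ idx e))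
                (weakComps (length idx) l)))
    (weakComps (length ks ∸ 1) (t ∸ l))))
  (upTo (suc t)))

{-# OPTIONS --safe #-}
module Submission where

open import Defs
open import Data.Nat using (ℕ; _≤_)
open import Data.Vec using (Vec; toList)
open import Data.Vec.Relation.Unary.All using (All)
open import Data.Product using (∃)
open import Data.Rational using (ℚ; 0ℚ; _<_; _-_; ∣_∣)

open import Algebra.Bundles using (CommutativeRing)
import Algebra.Properties.Ring as RingProperties
import Algebra.Properties.Semiring.Exp as Exp
import Algebra.Solver.Ring.NaturalCoefficients.Default as SemiringSolver
open import Data.Empty using (⊥-elim)
open import Data.Integer as ℤ using (+_; +[1+_])
import Data.Integer.Properties as ℤₚ
open import Data.List using (List; []; _∷_; _++_; map; concatMap; upTo; applyUpTo; replicate; zipWith; length; foldr)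
open import Data.Nat as ℕ using (zero; suc; _∸_; z≤n; s≤s)
import Data.Nat.Properties as ℕₚ
open import Data.Product using (_,_; _×_; proj₁; proj₂)
open import Data.Rational as ℚ using (mkℚ; toℚᵘ; 1ℚ)
import Data.Rational.Properties as ℚₚ
open import Data.Rational.Unnormalised as ℚᵘ using (mkℚᵘ; *≡*; *<*)
import Data.Rational.Unnormalised.Properties as ℚᵘₚ
open import Data.Sum using (inj₁; inj₂)
open import Function using (_∘_; id)
import Relation.Binary.PropositionalEquality as ≡
open ≡ using (_≡_)
import Relation.Binary.Reasoning.Setoid as SetoidReasoning

-- Multiply the t-th instance of the relation by xᵗ and sum over t.  On the left, the generating series of a
-- block is a word in the operators f ↦ ∫ f dt/t and f ↦ ∫ f dt/(1-t) with (1 - x ∫ dt/(1-t))⁻¹ inserted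
-- between the letters; these insertions telescope, i.e. they amount to conjugating the plain word by
-- multiplication with (1 - t)^{-x}.  On the right, raising the exponents and inserting 1s produces the factor
-- ∏ j/(j - x) over n_r ≤ j ≤ n₁.  The two agree because ∫₀¹ (1 - t)^{-x} t^{n-1} dt = n⁻¹ ∏_{j ≤ n} j/(j - x).
-- For sums truncated at M this becomes an exact identity of power series in x with the explicit remainder
--   ∑_{m ≤ M} H(m)/m · ∑_{i ≤ m} b_{M+1-i} c_{i-1},   (1-t)^{-x} = ∑ b_j t^j,   (1-t)^{x-1} = ∑ c_j t^j,
-- where H(m) is the part of the right-hand series with n₁ = m.  Its coefficients are O((log M)^d / M).

-- The sums compared are rational, so no function of t is ever formed: it is replaced by its
-- coefficient sequence, multiplication by t/(1-t) by the partial sums `σ`, and integration by `v`,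
-- the inverse of `1 + θ`. The variable x is formal too: `Transport` is applied over the ring of
-- power series in x. The conjugation is exact at every n and therefore survives truncation; only
-- the final beta integral does not. Cutting it at M leaves the tail, over n ≥ M, of a series with
-- terms proportional to b_(n-m)/(n+1), and `κ` is a finite closed form of this tail, normalised to
-- total 1. The tail is not uniformly small: for m close to M it is only bounded by a harmonic sum.
-- What rescues the estimate is a pair of factors 1/m, one explicit and one inside H(m). One of
-- them, multiplied into the tail and split by partial fractions, yields 1/M; the other is summed
-- over m at the price of a logarithm.

-- Formal power series: Cauchy product, Euler operator, partial sums.

module CauchyProduct {a ℓ} (A : CommutativeRing a ℓ) where
  open CommutativeRing A
  open SetoidReasoning setoid
  open SemiringSolver commutativeSemiring using (solve; _:+_; _:*_; _:=_; con)

  Seq : Set a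
  Seq = ℕ → Carrier

  infix 4 _≋_
  _≋_ : Seq → Seq → Set ℓ
  f ≋ g = ∀ n → f n ≈ g n

  Σ< : ℕ → Seq → Carrier
  Σ< zero    f = 0#
  Σ< (suc n) f = f 0 + Σ< n (f ∘ suc)

  Σ<-cong-< : ∀ n {f g} → (∀ i → i ℕ.< n → f i ≈ g i) → Σ< n f ≈ Σ< n g
  Σ<-cong-< zero    f≈g = refl
  Σ<-cong-< (suc n) f≈g =
    +-cong (f≈g 0 (ℕ.s≤s ℕ.z≤n)) (Σ<-cong-< n (λ i i<n → f≈g (suc i) (ℕ.s≤s i<n)))

  Σ<-cong : ∀ n {f g} → f ≋ g → Σ< n f ≈ Σ< n g
  Σ<-cong n f≈g = Σ<-cong-< n (λ i _ → f≈g i)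

  Σ<-last : ∀ n f → Σ< (suc n) f ≈ Σ< n f + f n
  Σ<-last zero    f = +-comm (f 0) 0#
  Σ<-last (suc n) f = trans (+-congˡ (Σ<-last n (f ∘ suc))) (sym (+-assoc _ _ _))

  Σ<-+ : ∀ n f g → Σ< n (λ i → f i + g i) ≈ Σ< n f + Σ< n g
  Σ<-+ zero    f g = sym (+-identityˡ 0#)
  Σ<-+ (suc n) f g = trans (+-congˡ (Σ<-+ n (f ∘ suc) (g ∘ suc)))
    (solve 4 (λ p q r s → p :+ q :+ (r :+ s) := p :+ r :+ (q :+ s)) refl _ _ _ _)

  *-Σ< : ∀ n c f → Σ< n (λ i → c * f i) ≈ c * Σ< n f
  *-Σ< zero    c f = sym (zeroʳ c)
  *-Σ< (suc n) c f = trans (+-congˡ (*-Σ< n c (f ∘ suc))) (sym (distribˡ c _ _))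

  Σ<-0 : ∀ n → Σ< n (λ _ → 0#) ≈ 0#
  Σ<-0 zero    = refl
  Σ<-0 (suc n) = trans (+-identityˡ _) (Σ<-0 n)

  infixl 7 _⊛_
  -- The Cauchy product, by recursion on the tail of the left factor: no index is subtracted, and
  -- the ring laws follow by plain induction.
  _⊛_ : Seq → Seq → Seq
  (f ⊛ g) zero    = f 0 * g 0
  (f ⊛ g) (suc n) = f 0 * g (suc n) + ((f ∘ suc) ⊛ g) n

  ⊛-cong : ∀ {f f′ g g′} → f ≋ f′ → g ≋ g′ → f ⊛ g ≋ f′ ⊛ g′
  ⊛-cong p q zero    = *-cong (p 0) (q 0)
  ⊛-cong p q (suc n) = +-cong (*-cong (p 0) (q (suc n))) (⊛-cong (p ∘ suc) q n)

  ⊛-suc : ∀ f g n → (f ⊛ g) (suc n) ≈ (f ⊛ (g ∘ suc)) n + f (suc n) * g 0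
  ⊛-suc f g zero    = refl
  ⊛-suc f g (suc n) = trans (+-congˡ (⊛-suc (f ∘ suc) g n)) (sym (+-assoc _ _ _))

  ⊛-comm : ∀ f g → f ⊛ g ≋ g ⊛ f
  ⊛-comm f g zero    = *-comm _ _
  ⊛-comm f g (suc n) = begin
    f 0 * g (suc n) + ((f ∘ suc) ⊛ g) n  ≈⟨ +-cong (*-comm _ _) (⊛-comm (f ∘ suc) g n) ⟩
    g (suc n) * f 0 + (g ⊛ (f ∘ suc)) n  ≈⟨ +-comm _ _ ⟩
    (g ⊛ (f ∘ suc)) n + g (suc n) * f 0  ≈⟨ ⊛-suc g f n ⟨
    (g ⊛ f) (suc n) ∎

  ⊛-distribʳ : ∀ h f g → (λ i → f i + g i) ⊛ h ≋ (λ n → (f ⊛ h) n + (g ⊛ h) n)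
  ⊛-distribʳ h f g zero    = distribʳ _ _ _
  ⊛-distribʳ h f g (suc n) = trans (+-cong (distribʳ _ _ _) (⊛-distribʳ h (f ∘ suc) (g ∘ suc) n))
    (solve 4 (λ p q r s → p :+ q :+ (r :+ s) := p :+ r :+ (q :+ s)) refl _ _ _ _)

  ⊛-distribˡ : ∀ h f g → h ⊛ (λ i → f i + g i) ≋ (λ n → (h ⊛ f) n + (h ⊛ g) n)
  ⊛-distribˡ h f g n = trans (⊛-comm h _ n)
    (trans (⊛-distribʳ h f g n) (+-cong (⊛-comm f h n) (⊛-comm g h n)))

  ⊛-*ˡ : ∀ c f g → (λ i → c * f i) ⊛ g ≋ (λ n → c * (f ⊛ g) n)
  ⊛-*ˡ c f g zero    = *-assoc _ _ _
  ⊛-*ˡ c f g (suc n) = trans (+-cong (*-assoc _ _ _) (⊛-*ˡ c (f ∘ suc) g n)) (sym (distribˡ _ _ _))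

  ⊛-*ʳ : ∀ c f g → f ⊛ (λ i → c * g i) ≋ (λ n → c * (f ⊛ g) n)
  ⊛-*ʳ c f g n = trans (⊛-comm f _ n) (trans (⊛-*ˡ c g f n) (*-congˡ (⊛-comm g f n)))

  ⊛-zeroˡ : ∀ g → (λ _ → 0#) ⊛ g ≋ (λ _ → 0#)
  ⊛-zeroˡ g zero    = zeroˡ _
  ⊛-zeroˡ g (suc n) = trans (+-cong (zeroˡ _) (⊛-zeroˡ g n)) (+-identityˡ 0#)

  ⊛-assoc : ∀ f g h → (f ⊛ g) ⊛ h ≋ f ⊛ (g ⊛ h)
  ⊛-assoc f g h zero    = *-assoc _ _ _
  ⊛-assoc f g h (suc n) = begin
    f 0 * g 0 * h (suc n) + (((f ⊛ g) ∘ suc) ⊛ h) n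
      ≈⟨ +-congˡ (⊛-distribʳ h (λ i → f 0 * g (suc i)) ((f ∘ suc) ⊛ g) n) ⟩
    f 0 * g 0 * h (suc n) + (((λ i → f 0 * g (suc i)) ⊛ h) n + (((f ∘ suc) ⊛ g) ⊛ h) n)
      ≈⟨ +-congˡ (+-cong (⊛-*ˡ (f 0) (g ∘ suc) h n) (⊛-assoc (f ∘ suc) g h n)) ⟩
    f 0 * g 0 * h (suc n) + (f 0 * ((g ∘ suc) ⊛ h) n + ((f ∘ suc) ⊛ (g ⊛ h)) n)
      ≈⟨ solve 5 (λ p q r s t → p :* q :* r :+ (p :* s :+ t) := p :* (q :* r :+ s) :+ t) refl _ _ _ _ _ ⟩
    f 0 * (g 0 * h (suc n) + ((g ∘ suc) ⊛ h) n) + ((f ∘ suc) ⊛ (g ⊛ h)) n ∎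

  const : Carrier → Seq
  const c zero    = c
  const c (suc n) = 0#

  const-⊛ : ∀ c f → const c ⊛ f ≋ (λ n → c * f n)
  const-⊛ c f zero    = refl
  const-⊛ c f (suc n) = trans (+-congˡ (⊛-zeroˡ f n)) (+-identityʳ _)

  shift : Seq → Seq
  shift f zero    = 0#
  shift f (suc n) = f n

  X : Seq
  X = shift (const 1#)

  X-⊛ : ∀ f → X ⊛ f ≋ shift f
  X-⊛ f zero    = zeroˡ _
  X-⊛ f (suc n) = trans (+-cong (zeroˡ _) (trans (const-⊛ 1# f n) (*-identityˡ _))) (+-identityˡ _)

  ⊛-as-Σ< : ∀ f g n → (f ⊛ g) n ≈ Σ< (suc n) (λ i → f i * g (n ℕ.∸ i))
  ⊛-as-Σ< f g zero    = sym (+-identityʳ _)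
  ⊛-as-Σ< f g (suc n) = +-congˡ (⊛-as-Σ< (f ∘ suc) g n)

  seqRing : CommutativeRing a ℓ
  seqRing = record
    { Carrier = Seq
    ; _≈_ = _≋_
    ; _+_ = λ f g n → f n + g n
    ; _*_ = _⊛_
    ; -_ = λ f n → - f n
    ; 0# = λ _ → 0#
    ; 1# = const 1#
    ; isCommutativeRing = record
      { isRing = record
        { +-isAbelianGroup = record
          { isGroup = record
            { isMonoid = record
              { isSemigroup = record
                { isMagma = record
                  { isEquivalence = record
                    { refl = λ n → refl ; sym = λ p n → sym (p n) ; trans = λ p q n → trans (p n) (q n) }
                  ; ∙-cong = λ p q n → +-cong (p n) (q n) }
                ; assoc = λ f g h n → +-assoc _ _ _ }
              ; identity = (λ f n → +-identityˡ _) , (λ f n → +-identityʳ _) }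
            ; inverse = (λ f n → -‿inverseˡ _) , (λ f n → -‿inverseʳ _)
            ; ⁻¹-cong = λ p n → -‿cong (p n) }
          ; comm = λ f g n → +-comm _ _ }
        ; *-cong = ⊛-cong
        ; *-assoc = ⊛-assoc
        ; *-identity = 1-⊛ , λ f n → trans (⊛-comm f _ n) (1-⊛ f n)
        ; distrib = ⊛-distribˡ , ⊛-distribʳ }
      ; *-comm = ⊛-comm } }
    where
    1-⊛ : ∀ f → const 1# ⊛ f ≋ f
    1-⊛ f n = trans (const-⊛ 1# f n) (*-identityˡ _)

  ι : ℕ → Carrier
  ι zero    = 0#
  ι (suc n) = 1# + ι n

  ι-+ : ∀ m n → ι (m ℕ.+ n) ≈ ι m + ι n
  ι-+ zero    n = sym (+-identityˡ _)
  ι-+ (suc m) n = trans (+-congˡ (ι-+ m n)) (sym (+-assoc _ _ _))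

  -- The Euler operator t d/dt; `θ-⊛` is its Leibniz rule.
  θ : Seq → Seq
  θ f n = ι n * f n

  θ-⊛ : ∀ f g n → θ (f ⊛ g) n ≈ (θ f ⊛ g) n + (f ⊛ θ g) n
  θ-⊛ f g zero    = solve 2 (λ p q → con 0 :* (p :* q) := con 0 :* p :* q :+ p :* (con 0 :* q)) refl _ _
  θ-⊛ f g (suc n) = begin
    (1# + ι n) * (f 0 * g (suc n) + (f′ ⊛ g) n)
      ≈⟨ solve 4 (λ i p q r → (con 1 :+ i) :* (p :* q :+ r) := (p :* ((con 1 :+ i) :* q) :+ r) :+ i :* r) refl _ _ _ _ ⟩
    (f 0 * ((1# + ι n) * g (suc n)) + (f′ ⊛ g) n) + ι n * (f′ ⊛ g) n
      ≈⟨ +-congˡ (θ-⊛ f′ g n) ⟩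
    (f 0 * ((1# + ι n) * g (suc n)) + (f′ ⊛ g) n) + ((θ f′ ⊛ g) n + (f′ ⊛ θ g) n)
      ≈⟨ solve 5 (λ p q r s t → (p :+ q) :+ (r :+ s) := (con 0 :* t) :+ (q :+ r) :+ (p :+ s)) refl _ _ _ _ (f 0 * g (suc n)) ⟩
    0# * (f 0 * g (suc n)) + ((f′ ⊛ g) n + (θ f′ ⊛ g) n) + (f 0 * ((1# + ι n) * g (suc n)) + (f′ ⊛ θ g) n)
      ≈⟨ +-congʳ (+-cong (sym (*-assoc _ _ _)) (sym (trans (⊛-cong θf′ (λ _ → refl) n) (⊛-distribʳ g f′ (θ f′) n)))) ⟩
    (θ f ⊛ g) (suc n) + (f ⊛ θ g) (suc n) ∎
    where
    f′ = f ∘ suc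
    θf′ : θ f ∘ suc ≋ (λ i → f′ i + θ f′ i)
    θf′ i = trans (distribʳ _ _ _) (+-congʳ (*-identityˡ _))

  -- Multiplication by t/(1-t), so that `σ-⊛` is an instance of associativity.
  σ : Seq → Seq
  σ f n = Σ< n f

  σ-⊛ : ∀ f g → f ⊛ σ g ≋ σ (f ⊛ g)
  σ-⊛ f g zero    = zeroʳ _
  σ-⊛ f g (suc n) = begin
    f 0 * σ g (suc n) + ((f ∘ suc) ⊛ σ g) n
      ≈⟨ +-congˡ (σ-⊛ (f ∘ suc) g n) ⟩
    f 0 * (g 0 + Σ< n (g ∘ suc)) + Σ< n ((f ∘ suc) ⊛ g)
      ≈⟨ +-congʳ (trans (distribˡ _ _ _) (+-congˡ (sym (*-Σ< n (f 0) (g ∘ suc))))) ⟩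
    f 0 * g 0 + Σ< n (λ i → f 0 * g (suc i)) + Σ< n ((f ∘ suc) ⊛ g)
      ≈⟨ trans (+-assoc _ _ _) (+-congˡ (sym (Σ<-+ n _ _))) ⟩
    f 0 * g 0 + Σ< n ((f ⊛ g) ∘ suc) ∎

-- Conjugation by (1-t)^(-x) and the truncated beta integral.

module Transport {a ℓ} (K : CommutativeRing a ℓ) where
  open CommutativeRing K
  open SetoidReasoning setoid
  open SemiringSolver commutativeSemiring using (solve; _:+_; _:*_; _:=_; con)
  open CauchyProduct K
  open Exp semiring using (_^_)

  +-cancelʳ : ∀ z {y y′} → y + z ≈ y′ + z → y ≈ y′
  +-cancelʳ z {y} {y′} = RingProperties.+-cancelʳ ring z y y′

  module _ (x : Carrier) (v p : ℕ → Carrier)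
           (ι*v≈1 : ∀ n → ι (suc n) * v n ≈ 1#)
           (p-unfold : ∀ n → p n ≈ 1# + x * v n * p n) where

    ι*v* : ∀ n y → ι (suc n) * (v n * y) ≈ y
    ι*v* n y = trans (sym (*-assoc _ _ _)) (trans (*-congʳ (ι*v≈1 n)) (*-identityˡ y))

    v*ι* : ∀ n y → v n * (ι (suc n) * y) ≈ y
    v*ι* n y = trans (solve 3 (λ p q r → p :* (q :* r) := q :* (p :* r)) refl _ _ _) (ι*v* n y)

    -- The expansion coefficients of (1 - t)^{-x} and of (1 - t)^{x-1}.
    b c : Seq
    b zero    = 1#
    b (suc j) = v j * ((ι j + x) * b j)
    c zero    = 1#
    c (suc j) = c j + - (x * v j * c j)

    b-rec : ∀ j → ι (suc j) * b (suc j) ≈ (ι j + x) * b j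
    b-rec j = ι*v* j _

    c-suc : ∀ j → c (suc j) + x * v j * c j ≈ c j
    c-suc j = trans (+-assoc _ _ _) (trans (+-congˡ (-‿inverseˡ _)) (+-identityʳ _))

    c-rec : ∀ j → ι (suc j) * c (suc j) + x * c j ≈ ι (suc j) * c j
    c-rec j = begin
      ι (suc j) * c (suc j) + x * c j
        ≈⟨ +-congˡ (ι*v* j _) ⟨
      ι (suc j) * c (suc j) + ι (suc j) * (v j * (x * c j))
        ≈⟨ solve 5 (λ i d v x c → i :* d :+ i :* (v :* (x :* c)) := i :* (d :+ x :* v :* c)) refl _ _ _ _ _ ⟩
      ι (suc j) * (c (suc j) + x * v j * c j)
        ≈⟨ *-congˡ (c-suc j) ⟩
      ι (suc j) * c j ∎

    -- `p n` is the inverse of 1 - x v n, the ratio of consecutive entries of `c`. Multiplying by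
    -- `c` thus cancels the products of `p` carried by the right-hand series.
    c*p : ∀ n → c (suc n) * p n ≈ c n
    c*p n = +-cancelʳ (x * v n * c n * p n) (begin
      c (suc n) * p n + x * v n * c n * p n  ≈⟨ distribʳ _ _ _ ⟨
      (c (suc n) + x * v n * c n) * p n      ≈⟨ *-cong (c-suc n) (p-unfold n) ⟩
      c n * (1# + x * v n * p n)             ≈⟨ solve 4 (λ x v c p → c :* (con 1 :+ x :* v :* p) := c :+ x :* v :* c :* p) refl _ _ _ _ ⟩
      c n + x * v n * c n * p n ∎)

    -- The differential equation t f' = x t/(1-t) f of f = (1-t)^(-x).
    θb≈x*σb : ∀ n → θ b n ≈ x * σ b n
    θb≈x*σb zero    = trans (zeroˡ _) (sym (zeroʳ x))
    θb≈x*σb (suc n) = begin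
      ι (suc n) * b (suc n)  ≈⟨ b-rec n ⟩
      (ι n + x) * b n        ≈⟨ distribʳ _ _ _ ⟩
      ι n * b n + x * b n    ≈⟨ +-congʳ (θb≈x*σb n) ⟩
      x * σ b n + x * b n    ≈⟨ distribˡ _ _ _ ⟨
      x * (σ b n + b n)      ≈⟨ *-congˡ (Σ<-last n b) ⟨
      x * σ b (suc n) ∎

    -- Conjugating `1 + θ` by `b` adds the term x σ: this is how the insertions between the letters
    -- arise from a single multiplication.
    b⊛-rec : ∀ h n → ι (suc n) * (b ⊛ h) n ≈ (b ⊛ (λ m → ι (suc m) * h m)) n + x * σ (b ⊛ h) n
    b⊛-rec h n = begin
      (1# + ι n) * (b ⊛ h) n
        ≈⟨ trans (distribʳ _ _ _) (+-congʳ (*-identityˡ _)) ⟩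
      (b ⊛ h) n + θ (b ⊛ h) n
        ≈⟨ +-congˡ (θ-⊛ b h n) ⟩
      (b ⊛ h) n + ((θ b ⊛ h) n + (b ⊛ θ h) n)
        ≈⟨ solve 3 (λ p q r → p :+ (q :+ r) := (p :+ r) :+ q) refl _ _ _ ⟩
      (b ⊛ h) n + (b ⊛ θ h) n + (θ b ⊛ h) n
        ≈⟨ +-cong (sym (trans (⊛-cong {b} (λ _ → refl) (λ m → trans (distribʳ _ _ _) (+-congʳ (*-identityˡ _))) n) (⊛-distribˡ b h (θ h) n))) θb⊛h ⟩
      (b ⊛ (λ m → ι (suc m) * h m)) n + x * σ (b ⊛ h) n ∎
      where
      θb⊛h : (θ b ⊛ h) n ≈ x * σ (b ⊛ h) n
      θb⊛h = begin
        (θ b ⊛ h) n              ≈⟨ ⊛-cong {g = h} θb≈x*σb (λ _ → refl) n ⟩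
        ((λ m → x * σ b m) ⊛ h) n  ≈⟨ ⊛-*ˡ x (σ b) h n ⟩
        x * (σ b ⊛ h) n          ≈⟨ *-congˡ (trans (⊛-comm (σ b) h n) (σ-⊛ h b n)) ⟩
        x * σ (h ⊛ b) n          ≈⟨ *-congˡ (Σ<-cong n (⊛-comm h b)) ⟩
        x * σ (b ⊛ h) n ∎

    -- (1-t)^(-x) (1-t)^(x-1) = 1/(1-t). The Leibniz rule with the recursions of `b` and `c` shows
    -- that consecutive coefficients agree; x (b ⊛ c) n is added on both sides to keep `θc-part`
    -- free of subtraction.
    b⊛c≈1 : ∀ n → (b ⊛ c) n ≈ 1#
    b⊛c≈1 zero    = *-identityˡ 1#
    b⊛c≈1 (suc n) = begin
      (b ⊛ c) (suc n)                       ≈⟨ v*ι* n _ ⟨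
      v n * (ι (suc n) * (b ⊛ c) (suc n))   ≈⟨ *-congˡ (+-cancelʳ _ step) ⟩
      v n * (ι (suc n) * (b ⊛ c) n)         ≈⟨ v*ι* n _ ⟩
      (b ⊛ c) n                             ≈⟨ b⊛c≈1 n ⟩
      1# ∎
      where
      θb-part : (θ b ⊛ c) (suc n) ≈ (θ b ⊛ c) n + x * (b ⊛ c) n
      θb-part = begin
        0# * 1# * c (suc n) + ((θ b ∘ suc) ⊛ c) n
          ≈⟨ +-cong (trans (*-assoc _ _ _) (zeroˡ _)) (⊛-cong {g = c} (λ j → trans (b-rec j) (distribʳ _ _ _)) (λ _ → refl) n) ⟩
        0# + ((λ j → ι j * b j + x * b j) ⊛ c) n
          ≈⟨ trans (+-identityˡ _) (⊛-distribʳ c (θ b) (λ j → x * b j) n) ⟩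
        (θ b ⊛ c) n + ((λ j → x * b j) ⊛ c) n
          ≈⟨ +-congˡ (⊛-*ˡ x b c n) ⟩
        (θ b ⊛ c) n + x * (b ⊛ c) n ∎
      θc-part : (b ⊛ θ c) (suc n) + x * (b ⊛ c) n ≈ (b ⊛ θ c) n + (b ⊛ c) n
      θc-part = begin
        (b ⊛ θ c) (suc n) + x * (b ⊛ c) n
          ≈⟨ +-congʳ (trans (⊛-suc b (θ c) n) (trans (+-congˡ (trans (*-congˡ (zeroˡ _)) (zeroʳ _))) (+-identityʳ _))) ⟩
        (b ⊛ (θ c ∘ suc)) n + x * (b ⊛ c) n
          ≈⟨ +-congˡ (⊛-*ʳ x b c n) ⟨
        (b ⊛ (θ c ∘ suc)) n + (b ⊛ (λ j → x * c j)) n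
          ≈⟨ ⊛-distribˡ b (θ c ∘ suc) (λ j → x * c j) n ⟨
        (b ⊛ (λ j → θ c (suc j) + x * c j)) n
          ≈⟨ ⊛-cong {b} (λ _ → refl) (λ j → trans (c-rec j) (trans (distribʳ _ _ _) (trans (+-congʳ (*-identityˡ _)) (+-comm _ _)))) n ⟩
        (b ⊛ (λ j → θ c j + c j)) n
          ≈⟨ ⊛-distribˡ b (θ c) c n ⟩
        (b ⊛ θ c) n + (b ⊛ c) n ∎
      step : ι (suc n) * (b ⊛ c) (suc n) + x * (b ⊛ c) n ≈ ι (suc n) * (b ⊛ c) n + x * (b ⊛ c) n
      step = begin
        ι (suc n) * (b ⊛ c) (suc n) + x * (b ⊛ c) n
          ≈⟨ +-congʳ (θ-⊛ b c (suc n)) ⟩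
        (θ b ⊛ c) (suc n) + (b ⊛ θ c) (suc n) + x * (b ⊛ c) n
          ≈⟨ trans (+-assoc _ _ _) (+-cong θb-part θc-part) ⟩
        (θ b ⊛ c) n + x * (b ⊛ c) n + ((b ⊛ θ c) n + (b ⊛ c) n)
          ≈⟨ solve 4 (λ p q r s → p :+ q :+ (r :+ s) := p :+ r :+ (s :+ q)) refl _ _ _ _ ⟩
        (θ b ⊛ c) n + (b ⊛ θ c) n + ((b ⊛ c) n + x * (b ⊛ c) n)
          ≈⟨ +-congʳ (θ-⊛ b c n) ⟨
        ι n * (b ⊛ c) n + ((b ⊛ c) n + x * (b ⊛ c) n)
          ≈⟨ solve 3 (λ i y z → i :* y :+ (y :+ z) := (con 1 :+ i) :* y :+ z) refl _ _ _ ⟩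
        ι (suc n) * (b ⊛ c) n + x * (b ⊛ c) n ∎

    -- `σ f n` involves only entries below n, so the recursion determines f.
    recursion-unique : ∀ {R f g : Seq} →
      (∀ n → f n ≈ v n * (R n + x * σ f n)) → (∀ n → g n ≈ v n * (R n + x * σ g n)) → f ≋ g
    recursion-unique {R} {f} {g} f-rec g-rec n = below (suc n) n ℕₚ.≤-refl
      where
      below : ∀ N i → i ℕ.< N → f i ≈ g i
      below (suc N) i (ℕ.s≤s i≤N) = begin
        f i                       ≈⟨ f-rec i ⟩
        v i * (R i + x * σ f i)   ≈⟨ *-congˡ (+-congˡ (*-congˡ (Σ<-cong-< i (λ j j<i → below N j (ℕₚ.<-≤-trans j<i i≤N))))) ⟩
        v i * (R i + x * σ g i)   ≈⟨ g-rec i ⟨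
        g i ∎

    -- The sum of c_i b_(m-i+j) over i ≤ m. It plays the role of the part n ≥ m + j of the series
    -- with terms (m+1) c_(m+1) b_(n-m)/(n+1). That series is the normalised beta integral of t^m
    -- (1-t)^(-x); its total 1 is `κ-total`.
    κ : ℕ → ℕ → Carrier
    κ zero    j = c 0 * b j
    κ (suc m) j = κ m (suc j) + c (suc m) * b j

    κ-as-⊛ : ∀ m j → κ m j ≈ (c ⊛ (λ i → b (i ℕ.+ j))) m
    κ-as-⊛ zero    j = refl
    κ-as-⊛ (suc m) j = trans (+-congʳ (trans (κ-as-⊛ m (suc j))
      (⊛-cong {c} (λ _ → refl) (λ i → reflexive (≡.cong b (ℕₚ.+-suc i j))) m))) (sym (⊛-suc c _ m))

    κ-total : ∀ m → κ m 0 ≈ 1#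
    κ-total m = begin
      κ m 0                          ≈⟨ κ-as-⊛ m 0 ⟩
      (c ⊛ (λ i → b (i ℕ.+ 0))) m    ≈⟨ ⊛-cong {c} (λ _ → refl) (λ i → reflexive (≡.cong b (ℕₚ.+-identityʳ i))) m ⟩
      (c ⊛ b) m                      ≈⟨ ⊛-comm c b m ⟩
      (b ⊛ c) m                      ≈⟨ b⊛c≈1 m ⟩
      1# ∎

    -- Consecutive tails differ by the term n = m + j. The induction on m closes because `I` splits
    -- both as (m+1) + (j+1) and as (m+2) + j, which suits `b-rec` and `c-rec`.
    κ-step : ∀ m j → ι (suc (m ℕ.+ j)) * κ m j ≈ ι (suc (m ℕ.+ j)) * κ m (suc j) + ι (suc m) * c (suc m) * b j
    κ-step zero j = sym (begin
      ι (suc j) * (c 0 * b (suc j)) + ι 1 * c 1 * b j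
        ≈⟨ +-congʳ (trans (solve 3 (λ p q r → p :* (q :* r) := q :* (p :* r)) refl _ _ _) (*-congˡ (b-rec j))) ⟩
      c 0 * ((ι j + x) * b j) + ι 1 * c 1 * b j
        ≈⟨ solve 5 (λ c i x b d → c :* ((i :+ x) :* b) :+ d :* b := i :* (c :* b) :+ (d :+ x :* c) :* b) refl _ _ _ _ _ ⟩
      ι j * (c 0 * b j) + (ι 1 * c 1 + x * c 0) * b j
        ≈⟨ +-congˡ (*-congʳ (c-rec 0)) ⟩
      ι j * (c 0 * b j) + ι 1 * c 0 * b j
        ≈⟨ solve 3 (λ i c b → i :* (c :* b) :+ (con 1 :+ con 0) :* c :* b := (con 1 :+ i) :* (c :* b)) refl _ _ _ ⟩
      ι (suc j) * (c 0 * b j) ∎)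
    κ-step (suc m) j = begin
      I * (κ m (suc j) + c (suc m) * b j)
        ≈⟨ distribˡ _ _ _ ⟩
      I * κ m (suc j) + I * (c (suc m) * b j)
        ≈⟨ +-congʳ (≡.subst (λ z → z * κ m (suc j) ≈ z * κ m (suc (suc j)) + ι (suc m) * c (suc m) * b (suc j))
                             (≡.cong (ι ∘ suc) (ℕₚ.+-suc m j)) (κ-step m (suc j))) ⟩
      I * κ m (suc (suc j)) + ι (suc m) * c (suc m) * b (suc j) + I * (c (suc m) * b j)
        ≈⟨ +-assoc _ _ _ ⟩
      I * κ m (suc (suc j)) + (ι (suc m) * c (suc m) * b (suc j) + I * (c (suc m) * b j))
        ≈⟨ +-congˡ (sym kernel) ⟩
      I * κ m (suc (suc j)) + (I * (c (suc m) * b (suc j)) + ι (suc (suc m)) * c (suc (suc m)) * b j)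
        ≈⟨ trans (sym (+-assoc _ _ _)) (+-congʳ (sym (distribˡ _ _ _))) ⟩
      I * (κ m (suc (suc j)) + c (suc m) * b (suc j)) + ι (suc (suc m)) * c (suc (suc m)) * b j ∎
      where
      I = ι (suc (suc m ℕ.+ j))
      I≈₁ : I ≈ ι (suc m) + ι (suc j)
      I≈₁ = trans (+-congˡ (+-congˡ (ι-+ m j))) (solve 2 (λ m j → con 1 :+ (con 1 :+ (m :+ j)) := (con 1 :+ m) :+ (con 1 :+ j)) refl _ _)
      I≈₂ : I ≈ ι (suc (suc m)) + ι j
      I≈₂ = trans I≈₁ (solve 2 (λ m j → (con 1 :+ m) :+ (con 1 :+ j) := con 1 :+ (con 1 :+ m) :+ j) refl _ _)
      kernel : I * (c (suc m) * b (suc j)) + ι (suc (suc m)) * c (suc (suc m)) * b j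
             ≈ ι (suc m) * c (suc m) * b (suc j) + I * (c (suc m) * b j)
      kernel = begin
        I * (c (suc m) * b (suc j)) + ι (suc (suc m)) * c (suc (suc m)) * b j
          ≈⟨ +-congʳ (trans (*-congʳ I≈₁) (solve 4 (λ m j c b → (m :+ j) :* (c :* b) := m :* c :* b :+ c :* (j :* b)) refl _ _ _ _)) ⟩
        ι (suc m) * c (suc m) * b (suc j) + c (suc m) * (ι (suc j) * b (suc j)) + ι (suc (suc m)) * c (suc (suc m)) * b j
          ≈⟨ +-congʳ (+-congˡ (*-congˡ (b-rec j))) ⟩
        ι (suc m) * c (suc m) * b (suc j) + c (suc m) * ((ι j + x) * b j) + ι (suc (suc m)) * c (suc (suc m)) * b j
          ≈⟨ solve 6 (λ A c i x b d → A :+ c :* ((i :+ x) :* b) :+ d :* b := A :+ (i :* (c :* b) :+ (d :+ x :* c) :* b)) refl _ _ _ _ _ _ ⟩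
        ι (suc m) * c (suc m) * b (suc j) + (ι j * (c (suc m) * b j) + (ι (suc (suc m)) * c (suc (suc m)) + x * c (suc m)) * b j)
          ≈⟨ +-congˡ (+-congˡ (*-congʳ (c-rec (suc m)))) ⟩
        ι (suc m) * c (suc m) * b (suc j) + (ι j * (c (suc m) * b j) + ι (suc (suc m)) * c (suc m) * b j)
          ≈⟨ +-congˡ (trans (solve 4 (λ i c b k → i :* (c :* b) :+ k :* c :* b := (k :+ i) :* (c :* b)) refl _ _ _ _) (*-congʳ (sym I≈₂))) ⟩
        ι (suc m) * c (suc m) * b (suc j) + I * (c (suc m) * b j) ∎

    -- G and H are the generating series of the two sides with the largest variable n₁ held fixed, and
    -- D and O are the series that remain when the first letter is removed.  The entry kᵢ of the paper is
    -- represented by kᵢ - 1, and the summation variable nᵢ by nᵢ - 1.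
    module _ (G : ℕ → List ℕ → Seq) (D : List ℕ → Seq)
             (H : ℕ → List ℕ → Seq) (O : List ℕ → Seq)
             (D-[] : ∀ n → D [] n ≈ 1#)
             (D-∷ : ∀ k ks n → D (k ∷ ks) n ≈ σ (G k ks) n)
             (G-zero : ∀ ks n → G 0 ks n ≈ v n * (D ks n + x * D (0 ∷ ks) n))
             (G-suc : ∀ k ks n → G (suc k) ks n ≈ v n * (G k ks n + x * D (suc k ∷ ks) n))
             (O-[] : ∀ n → O [] n ≈ 1#)
             (O-zero : ∀ k ks → O (k ∷ ks) 0 ≈ 0#)
             (O-suc : ∀ k ks n → O (k ∷ ks) (suc n) ≈ p n * O (k ∷ ks) n + H k ks n)
             (H-rec : ∀ k ks n → H k ks n ≈ v n ^ suc k * (p n * O ks n)) where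

      -- Multiplied by `c`, the right-hand series lose their factors `p`: `g` and `s` obey the
      -- recursions of the plain word, in which x no longer occurs (`s-∷`, `g-zero`, `g-suc`).
      g : ℕ → List ℕ → Seq
      g k ks n = c (suc n) * H k ks n

      s : List ℕ → Seq
      s ks n = c n * O ks n

      s-∷ : ∀ k ks → s (k ∷ ks) ≋ σ (g k ks)
      s-∷ k ks zero    = trans (*-congˡ (O-zero k ks)) (zeroʳ _)
      s-∷ k ks (suc n) = begin
        c (suc n) * O (k ∷ ks) (suc n)
          ≈⟨ *-congˡ (O-suc k ks n) ⟩
        c (suc n) * (p n * O (k ∷ ks) n + H k ks n)
          ≈⟨ solve 4 (λ c p o h → c :* (p :* o :+ h) := c :* p :* o :+ c :* h) refl _ _ _ _ ⟩
        c (suc n) * p n * O (k ∷ ks) n + g k ks n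
          ≈⟨ +-congʳ (*-congʳ (c*p n)) ⟩
        s (k ∷ ks) n + g k ks n
          ≈⟨ +-congʳ (s-∷ k ks n) ⟩
        σ (g k ks) n + g k ks n
          ≈⟨ Σ<-last n _ ⟨
        σ (g k ks) (suc n) ∎

      g-zero : ∀ ks n → ι (suc n) * g 0 ks n ≈ s ks n
      g-zero ks n = begin
        ι (suc n) * (c (suc n) * H 0 ks n)
          ≈⟨ *-congˡ (*-congˡ (H-rec 0 ks n)) ⟩
        ι (suc n) * (c (suc n) * (v n * 1# * (p n * O ks n)))
          ≈⟨ *-congˡ (solve 4 (λ c v p o → c :* (v :* con 1 :* (p :* o)) := v :* (c :* p :* o)) refl _ _ _ _) ⟩
        ι (suc n) * (v n * (c (suc n) * p n * O ks n))
          ≈⟨ ι*v* n _ ⟩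
        c (suc n) * p n * O ks n
          ≈⟨ *-congʳ (c*p n) ⟩
        c n * O ks n ∎

      g-suc : ∀ k ks n → ι (suc n) * g (suc k) ks n ≈ g k ks n
      g-suc k ks n = begin
        ι (suc n) * (c (suc n) * H (suc k) ks n)
          ≈⟨ *-congˡ (*-congˡ (H-rec (suc k) ks n)) ⟩
        ι (suc n) * (c (suc n) * (v n * v n ^ suc k * (p n * O ks n)))
          ≈⟨ *-congˡ (solve 4 (λ c v w r → c :* (v :* w :* r) := v :* (c :* (w :* r))) refl _ _ _ _) ⟩
        ι (suc n) * (v n * (c (suc n) * (v n ^ suc k * (p n * O ks n))))
          ≈⟨ ι*v* n _ ⟩
        c (suc n) * (v n ^ suc k * (p n * O ks n))
          ≈⟨ *-congˡ (H-rec k ks n) ⟨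
        g k ks n ∎

      -- A plain letter `v`, seen after multiplication by `b`, satisfies exactly the recursion that
      -- `G-zero` and `G-suc` prescribe for the left-hand series.
      b⊛-solves : ∀ {f h : Seq} → (∀ n → ι (suc n) * f n ≈ h n) →
        ∀ n → (b ⊛ f) n ≈ v n * ((b ⊛ h) n + x * σ (b ⊛ f) n)
      b⊛-solves {f} {h} ιf≈h n = begin
        (b ⊛ f) n
          ≈⟨ v*ι* n _ ⟨
        v n * (ι (suc n) * (b ⊛ f) n)
          ≈⟨ *-congˡ (b⊛-rec f n) ⟩
        v n * ((b ⊛ (λ m → ι (suc m) * f m)) n + x * σ (b ⊛ f) n)
          ≈⟨ *-congˡ (+-congʳ (⊛-cong {b} (λ _ → refl) ιf≈h n)) ⟩
        v n * ((b ⊛ h) n + x * σ (b ⊛ f) n) ∎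

      -- Mutual induction along the word; the empty word is `b⊛c≈1`, and each letter is settled by
      -- uniqueness of the solution of its recursion.
      D≋b⊛s : ∀ ks → D ks ≋ b ⊛ s ks
      G≋b⊛g : ∀ k ks → G k ks ≋ b ⊛ g k ks

      D≋b⊛s [] n = begin
        D [] n                         ≈⟨ D-[] n ⟩
        1#                             ≈⟨ b⊛c≈1 n ⟨
        (b ⊛ c) n                      ≈⟨ ⊛-cong {b} (λ _ → refl) (λ m → trans (*-congˡ (O-[] m)) (*-identityʳ _)) n ⟨
        (b ⊛ s []) n ∎
      D≋b⊛s (k ∷ ks) n = begin
        D (k ∷ ks) n         ≈⟨ D-∷ k ks n ⟩
        σ (G k ks) n         ≈⟨ Σ<-cong n (G≋b⊛g k ks) ⟩
        σ (b ⊛ g k ks) n     ≈⟨ σ-⊛ b (g k ks) n ⟨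
        (b ⊛ σ (g k ks)) n   ≈⟨ ⊛-cong {b} (λ _ → refl) (s-∷ k ks) n ⟨
        (b ⊛ s (k ∷ ks)) n ∎

      G≋b⊛g zero ks = recursion-unique
        (λ n → trans (G-zero ks n) (*-congˡ (+-cong (D≋b⊛s ks n) (*-congˡ (D-∷ 0 ks n)))))
        (b⊛-solves (g-zero ks))
      G≋b⊛g (suc k) ks = recursion-unique
        (λ n → trans (G-suc k ks n) (*-congˡ (+-cong (G≋b⊛g k ks n) (*-congˡ (D-∷ (suc k) ks n)))))
        (b⊛-solves (g-suc k ks))

      error : ℕ → List ℕ → Seq
      error k ks M = Σ< M (λ m → v m * H k ks m * κ m (M ℕ.∸ m))

      -- `κ-step` at j = M - m, divided by M + 1; its factor m + 1 cancels against `v m`.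
      error-step : ∀ k ks M m → m ℕ.≤ M →
        v m * H k ks m * κ m (M ℕ.∸ m)
          ≈ v m * H k ks m * κ m (suc M ℕ.∸ m) + v M * (g k ks m * b (M ℕ.∸ m))
      error-step k ks M m m≤M rewrite ℕₚ.+-∸-assoc 1 m≤M = begin
        v m * h * κ m j
          ≈⟨ v*ι* M _ ⟨
        v M * (ι (suc M) * (v m * h * κ m j))
          ≈⟨ *-congˡ (solve 3 (λ i w z → i :* (w :* z) := w :* (i :* z)) refl _ _ _) ⟩
        v M * (v m * h * (ι (suc M) * κ m j))
          ≈⟨ *-congˡ (*-congˡ (≡.subst (λ N → ι (suc N) * κ m j ≈ ι (suc N) * κ m (suc j) + ι (suc m) * c (suc m) * b j)
                                        (ℕₚ.m+[n∸m]≡n m≤M) (κ-step m j))) ⟩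
        v M * (v m * h * (ι (suc M) * κ m (suc j) + ι (suc m) * c (suc m) * b j))
          ≈⟨ solve 8 (λ vM vm h iM z im c b → vM :* (vm :* h :* (iM :* z :+ im :* c :* b))
                       := vM :* (iM :* (vm :* h :* z)) :+ vM :* (vm :* (im :* (c :* h :* b)))) refl _ _ _ _ _ _ _ _ ⟩
        v M * (ι (suc M) * (v m * h * κ m (suc j))) + v M * (v m * (ι (suc m) * (c (suc m) * h * b j)))
          ≈⟨ +-cong (v*ι* M _) (*-congˡ (v*ι* m _)) ⟩
        v m * h * κ m (suc j) + v M * (c (suc m) * h * b j) ∎
        where
        j = M ℕ.∸ m
        h = H k ks m

      -- When M grows by one, every tail `κ m (M - m)` loses its term n = M. The lost terms add up
      -- to `v M * (b ⊛ g) M`, which is the new summand on the left-hand side.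
      transport : ∀ k ks M →
        Σ< M (λ n → v n * H k ks n) ≈ Σ< M (λ n → v n * G k ks n) + error k ks M
      transport k ks zero    = sym (+-identityʳ _)
      transport k ks (suc M) = begin
        Σ< (suc M) vH
          ≈⟨ Σ<-last M _ ⟩
        Σ< M vH + vH M
          -- The new summand enters the error with the full series, `κ M 0 = 1`, before its first
          -- term is split off.
          ≈⟨ +-cong (transport k ks M) vH-last ⟩
        Σ< M vG + error k ks M + vH M * κ M (M ℕ.∸ M)
          ≈⟨ trans (+-assoc _ _ _) (+-congˡ (sym (Σ<-last M _))) ⟩
        Σ< M vG + Σ< (suc M) (λ m → vH m * κ m (M ℕ.∸ m))
          ≈⟨ +-congˡ (Σ<-cong-< (suc M) (λ m m<1+M → error-step k ks M m (ℕₚ.≤-pred m<1+M))) ⟩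
        Σ< M vG + Σ< (suc M) (λ m → vH m * κ m (suc M ℕ.∸ m) + v M * gb m)
          ≈⟨ +-congˡ (trans (Σ<-+ (suc M) (λ m → vH m * κ m (suc M ℕ.∸ m)) (λ m → v M * gb m)) (+-congˡ (trans (*-Σ< (suc M) (v M) gb) (*-congˡ g⊛b)))) ⟩
        Σ< M vG + (error k ks (suc M) + vG M)
          ≈⟨ solve 3 (λ p q r → p :+ (q :+ r) := p :+ r :+ q) refl _ _ _ ⟩
        Σ< M vG + vG M + error k ks (suc M)
          ≈⟨ +-congʳ (Σ<-last M _) ⟨
        Σ< (suc M) vG + error k ks (suc M) ∎
        where
        vH vG gb : Seq
        vH n = v n * H k ks n
        vG n = v n * G k ks n
        gb m = g k ks m * b (M ℕ.∸ m)
        vH-last : vH M ≈ vH M * κ M (M ℕ.∸ M)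
        vH-last = sym (trans (*-congˡ (trans (reflexive (≡.cong (κ M) (ℕₚ.n∸n≡0 M))) (κ-total M))) (*-identityʳ _))
        g⊛b : Σ< (suc M) gb ≈ G k ks M
        g⊛b = begin
          Σ< (suc M) gb      ≈⟨ ⊛-as-Σ< (g k ks) b M ⟨
          (g k ks ⊛ b) M     ≈⟨ ⊛-comm (g k ks) b M ⟩
          (b ⊛ g k ks) M     ≈⟨ G≋b⊛g k ks M ⟨
          G k ks M ∎

-- Sums over the two families of indices and their recursions in the leading entry.

module IndexSums {a ℓ} (A : CommutativeRing a ℓ) where
  open CommutativeRing A
  open CauchyProduct A

  private variable
    B C : Set

  +-interchange : ∀ p q r s → p + q + (r + s) ≈ p + r + (q + s)
  +-interchange p q r s = trans (+-assoc p q (r + s)) (trans (+-congˡ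
    (trans (sym (+-assoc q r s)) (trans (+-congʳ (+-comm q r)) (+-assoc r q s)))) (sym (+-assoc p r (q + s))))

  idx-cong : (F : B → Carrier) {i j : B} → i ≡ j → F i ≈ F j
  idx-cong F i≡j = reflexive (≡.cong F i≡j)

  abstract
    sumOver : (B → Carrier) → List B → Carrier
    sumOver F []       = 0#
    sumOver F (x ∷ xs) = F x + sumOver F xs

    sumOver-[] : ∀ (F : B → Carrier) → sumOver F [] ≈ 0#
    sumOver-[] F = refl

    sumOver-[-] : ∀ (F : B → Carrier) x → sumOver F (x ∷ []) ≈ F x
    sumOver-[-] F x = +-identityʳ _

    sumOver-foldr : ∀ (F : B → Carrier) xs → sumOver F xs ≡ foldr _+_ 0# (map F xs)
    sumOver-foldr F []       = ≡.refl
    sumOver-foldr F (x ∷ xs) = ≡.cong (λ y → F x + y) (sumOver-foldr F xs)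

    sumOver-cong : ∀ {F G : B → Carrier} → (∀ a → F a ≈ G a) → ∀ xs → sumOver F xs ≈ sumOver G xs
    sumOver-cong F≗G []       = refl
    sumOver-cong F≗G (x ∷ xs) = +-cong (F≗G x) (sumOver-cong F≗G xs)

    sumOver-++ : ∀ (F : B → Carrier) xs ys → sumOver F (xs ++ ys) ≈ sumOver F xs + sumOver F ys
    sumOver-++ F []       ys = sym (+-identityˡ _)
    sumOver-++ F (x ∷ xs) ys = trans (+-congˡ (sumOver-++ F xs ys)) (sym (+-assoc _ _ _))

    sumOver-map : ∀ (F : C → Carrier) (h : B → C) xs → sumOver F (map h xs) ≈ sumOver (F ∘ h) xs
    sumOver-map F h []       = refl
    sumOver-map F h (x ∷ xs) = +-congˡ (sumOver-map F h xs)

    sumOver-concatMap : ∀ (F : C → Carrier) (h : B → List C) xs → sumOver F (concatMap h xs) ≈ sumOver (λ a → sumOver F (h a)) xs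
    sumOver-concatMap F h []       = refl
    sumOver-concatMap F h (x ∷ xs) = trans (sumOver-++ F (h x) _) (+-congˡ (sumOver-concatMap F h xs))

    sumOver-Σ< : ∀ n (F : ℕ → B → Carrier) xs → sumOver (λ a → Σ< n (λ l → F l a)) xs ≈ Σ< n (λ l → sumOver (F l) xs)
    sumOver-Σ< n F []       = sym (Σ<-0 n)
    sumOver-Σ< n F (x ∷ xs) = trans (+-congˡ (sumOver-Σ< n F xs)) (sym (Σ<-+ n (λ l → F l x) _))

    sumOver-0 : ∀ (xs : List B) → sumOver (λ _ → 0#) xs ≈ 0#
    sumOver-0 []       = refl
    sumOver-0 (x ∷ xs) = trans (+-identityˡ _) (sumOver-0 xs)

    sumOver-+ : ∀ (F G : B → Carrier) xs → sumOver (λ a → F a + G a) xs ≈ sumOver F xs + sumOver G xs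
    sumOver-+ F G []       = sym (+-identityˡ _)
    sumOver-+ F G (x ∷ xs) = trans (+-congˡ (sumOver-+ F G xs)) (+-interchange _ _ _ _)

    *-sumOver : ∀ c (F : B → Carrier) xs → sumOver (λ a → c * F a) xs ≈ c * sumOver F xs
    *-sumOver c F []       = sym (zeroʳ c)
    *-sumOver c F (x ∷ xs) = trans (+-congˡ (*-sumOver c F xs)) (sym (distribˡ c _ _))

    sumOver-swap : ∀ (F : B → C → Carrier) xs ys →
      sumOver (λ a → sumOver (F a) ys) xs ≈ sumOver (λ z → sumOver (λ a → F a z) xs) ys
    sumOver-swap F []       ys = sym (sumOver-0 ys)
    sumOver-swap F (x ∷ xs) ys = trans (+-congˡ (sumOver-swap F xs ys)) (sym (sumOver-+ (F x) _ ys))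

    sumOver-applyUpTo : ∀ (F : B → Carrier) h n → sumOver F (applyUpTo h n) ≈ Σ< n (F ∘ h)
    sumOver-applyUpTo F h zero    = refl
    sumOver-applyUpTo F h (suc n) = +-congˡ (sumOver-applyUpTo F (h ∘ suc) n)

  sumOver-upTo : ∀ F n → sumOver F (upTo n) ≈ Σ< n F
  sumOver-upTo F n = sumOver-applyUpTo F id n

  antidiagonal : ℕ → (ℕ → ℕ → Carrier) → Carrier
  antidiagonal zero    f = f 0 0
  antidiagonal (suc t) f = f 0 (suc t) + antidiagonal t (f ∘ suc)

  antidiagonal-cong : ∀ t {f g} → (∀ s u → f s u ≈ g s u) → antidiagonal t f ≈ antidiagonal t g
  antidiagonal-cong zero    f≗g = f≗g 0 0
  antidiagonal-cong (suc t) f≗g = +-cong (f≗g 0 (suc t)) (antidiagonal-cong t (f≗g ∘ suc))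

  antidiagonal-0 : ∀ t {f} → (∀ s u → f s u ≈ 0#) → antidiagonal t f ≈ 0#
  antidiagonal-0 zero    f≗0 = f≗0 0 0
  antidiagonal-0 (suc t) f≗0 = trans (+-cong (f≗0 0 (suc t)) (antidiagonal-0 t (f≗0 ∘ suc))) (+-identityˡ 0#)

  antidiagonal-+ : ∀ t f g → antidiagonal t (λ s u → f s u + g s u) ≈ antidiagonal t f + antidiagonal t g
  antidiagonal-+ zero    f g = refl
  antidiagonal-+ (suc t) f g = trans (+-congˡ (antidiagonal-+ t (f ∘ suc) (g ∘ suc))) (+-interchange _ _ _ _)

  antidiagonal-Σ< : ∀ t n (f : ℕ → ℕ → ℕ → Carrier) →
    antidiagonal t (λ s u → Σ< n (λ l → f l s u)) ≈ Σ< n (λ l → antidiagonal t (f l))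
  antidiagonal-Σ< zero    n f = refl
  antidiagonal-Σ< (suc t) n f = trans (+-congˡ (antidiagonal-Σ< t n (λ l → f l ∘ suc))) (sym (Σ<-+ n (λ l → f l 0 (suc t)) _))

  *-antidiagonal : ∀ t c f → antidiagonal t (λ s u → c * f s u) ≈ c * antidiagonal t f
  *-antidiagonal zero    c f = refl
  *-antidiagonal (suc t) c f = trans (+-congˡ (*-antidiagonal t c (f ∘ suc))) (sym (distribˡ c _ _))

  Σ<-antidiagonal : ∀ t f → Σ< (suc t) (λ l → f l (t ∸ l)) ≈ antidiagonal t f
  Σ<-antidiagonal zero    f = +-identityʳ _
  Σ<-antidiagonal (suc t) f = +-congˡ (Σ<-antidiagonal t (f ∘ suc))

  -- `h` is the part that uses up one unit of s; in the generating series it carries a factor x.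
  antidiagonal-splitˡ : ∀ t {f g h} → (∀ u → f 0 u ≈ g 0 u) → (∀ s u → f (suc s) u ≈ g (suc s) u + h s u) →
    antidiagonal t f ≈ antidiagonal t g + shift (λ t → antidiagonal t h) t
  antidiagonal-splitˡ zero    f₀ f₊ = trans (f₀ 0) (sym (+-identityʳ _))
  antidiagonal-splitˡ (suc t) {f} {g} {h} f₀ f₊ = trans
    (+-cong (f₀ (suc t)) (trans (antidiagonal-cong t f₊) (antidiagonal-+ t (g ∘ suc) h)))
    (sym (+-assoc _ _ _))

  antidiagonal-splitʳ : ∀ t {f g h} → (∀ s → f s 0 ≈ g s 0) → (∀ s u → f s (suc u) ≈ g s (suc u) + h s u) →
    antidiagonal t f ≈ antidiagonal t g + shift (λ t → antidiagonal t h) t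
  antidiagonal-splitʳ zero    f₀ f₊ = trans (f₀ 0) (sym (+-identityʳ _))
  antidiagonal-splitʳ (suc zero) {f} {g} {h} f₀ f₊ = trans
    (+-cong (f₊ 0 0) (f₀ 1))
    (trans (+-assoc (g 0 1) (h 0 0) (g 1 0)) (trans (+-congˡ (+-comm (h 0 0) (g 1 0))) (sym (+-assoc (g 0 1) (g 1 0) (h 0 0)))))
  antidiagonal-splitʳ (suc (suc t)) {f} {g} {h} f₀ f₊ = trans
    (+-cong (f₊ 0 (suc t)) (antidiagonal-splitʳ (suc t) {f ∘ suc} {g ∘ suc} {h ∘ suc} (f₀ ∘ suc) (f₊ ∘ suc)))
    (+-interchange _ _ _ _)

  sum-posComps : ∀ F m w → sumOver F (posComps (suc m) w) ≈ Σ< w (λ j → sumOver (λ a → F (suc j ∷ a)) (posComps m (w ∸ suc j)))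
  sum-posComps F m w = trans (sumOver-concatMap F _ (upTo w))
    (trans (sumOver-upTo _ w) (Σ<-cong w (λ j → sumOver-map F (suc j ∷_) _)))

  posComps-split : ∀ F m w → sumOver F (posComps (suc m) (suc w))
    ≈ sumOver (λ a → F (1 ∷ a)) (posComps m w) + sumOver (F ∘ incrFirst) (posComps (suc m) w)
  posComps-split F m w = trans (sum-posComps F m (suc w)) (+-congˡ (sym (sum-posComps (F ∘ incrFirst) m w)))

  posComps-cong : ∀ {F G} m w → (∀ j a → F (suc j ∷ a) ≈ G (suc j ∷ a)) →
    sumOver F (posComps (suc m) w) ≈ sumOver G (posComps (suc m) w)
  posComps-cong {F} {G} m w F≗G = trans (sum-posComps F m w)
    (trans (Σ<-cong w (λ j → sumOver-cong (F≗G j) (posComps m (w ∸ suc j)))) (sym (sum-posComps G m w)))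

  posComps-empty : ∀ F {m w} → w ℕ.< m → sumOver F (posComps m w) ≈ 0#
  posComps-empty F {suc m} {zero}  _           = sumOver-[] F
  posComps-empty F {suc m} {suc w} (ℕ.s≤s w<m) = trans (posComps-split F m w)
    (trans (+-cong (posComps-empty (λ a → F (1 ∷ a)) w<m) (posComps-empty (F ∘ incrFirst) (ℕₚ.m<n⇒m<1+n w<m))) (+-identityˡ 0#))

  posComps-antidiagonal : ∀ F r t → sumOver F (posComps (suc r) (suc r ℕ.+ t))
    ≈ antidiagonal t (λ s u → sumOver (λ ms → F (suc s ∷ ms)) (posComps r (r ℕ.+ u)))
  posComps-antidiagonal F r zero = trans (posComps-split F r (r ℕ.+ 0))
    (trans (+-congˡ (posComps-empty (F ∘ incrFirst) (ℕ.s≤s (ℕₚ.≤-reflexive (ℕₚ.+-identityʳ r))))) (+-identityʳ _))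
  posComps-antidiagonal F r (suc t) = trans (posComps-split F r (r ℕ.+ suc t))
    (+-congˡ (trans (idx-cong (λ w → sumOver (F ∘ incrFirst) (posComps (suc r) w)) (ℕₚ.+-suc r t))
                        (posComps-antidiagonal (F ∘ incrFirst) r t)))

  sum-weakComps : ∀ F r n → sumOver F (weakComps (suc r) n) ≈ Σ< (suc n) (λ j → sumOver (λ a → F (j ∷ a)) (weakComps r (n ∸ j)))
  sum-weakComps F r n = trans (sumOver-concatMap F _ (upTo (suc n)))
    (trans (sumOver-upTo _ (suc n)) (Σ<-cong (suc n) (λ j → sumOver-map F (j ∷_) (weakComps r (n ∸ j)))))

  weakComps-zero : ∀ F r → sumOver F (weakComps (suc r) 0) ≈ sumOver (λ a → F (0 ∷ a)) (weakComps r 0)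
  weakComps-zero F r = trans (sum-weakComps F r 0) (+-identityʳ _)

  weakComps-split : ∀ F r n → sumOver F (weakComps (suc r) (suc n))
    ≈ sumOver (λ a → F (0 ∷ a)) (weakComps r (suc n)) + sumOver (F ∘ incrFirst) (weakComps (suc r) n)
  weakComps-split F r n = trans (sum-weakComps F r (suc n)) (+-congˡ (sym (sum-weakComps (F ∘ incrFirst) r n)))

  weakComps-cong : ∀ {F G} r n → (∀ j a → F (j ∷ a) ≈ G (j ∷ a)) →
    sumOver F (weakComps (suc r) n) ≈ sumOver G (weakComps (suc r) n)
  weakComps-cong {F} {G} r n F≗G = trans (sum-weakComps F r n)
    (trans (Σ<-cong (suc n) (λ j → sumOver-cong (F≗G j) (weakComps r (n ∸ j)))) (sym (sum-weakComps G r n)))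

  blocks : List ℕ → List ℕ → List (List ℕ)
  blocks ks ms = concatChoices (zipWith (λ k m → posComps m (k ℕ.+ m ∸ 1)) ks ms)

  lhsSum : List ℕ → (List ℕ → Carrier) → ℕ → Carrier
  lhsSum ks F t = sumOver (λ ms → sumOver F (blocks ks ms)) (posComps (length ks) (length ks ℕ.+ t))

  lhsSum-cong : ∀ ks t {F G} → (∀ i → F i ≈ G i) → lhsSum ks F t ≈ lhsSum ks G t
  lhsSum-cong ks t F≗G = sumOver-cong (λ ms → sumOver-cong F≗G (blocks ks ms)) (posComps (length ks) (length ks ℕ.+ t))

  lhsSum-Σ< : ∀ ks t n (F : ℕ → List ℕ → Carrier) → lhsSum ks (λ i → Σ< n (λ l → F l i)) t ≈ Σ< n (λ l → lhsSum ks (F l) t)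
  lhsSum-Σ< ks t n F = trans (sumOver-cong (λ ms → sumOver-Σ< n F (blocks ks ms)) _) (sumOver-Σ< n (λ l ms → sumOver (F l) (blocks ks ms)) _)

  *-lhsSum : ∀ ks t c F → lhsSum ks (λ i → c * F i) t ≈ c * lhsSum ks F t
  *-lhsSum ks t c F = trans (sumOver-cong (λ ms → *-sumOver c F (blocks ks ms)) _) (*-sumOver c (λ ms → sumOver F (blocks ks ms)) _)

  -- A block of s + 1 entries has weight k + s, so s is the share of t spent in the first block and
  -- u is left for the others.
  lhsSum-∷ : ∀ k ks F t → lhsSum (k ∷ ks) F t
    ≈ antidiagonal t (λ s u → sumOver (λ a → lhsSum ks (F ∘ (a ++_)) u) (posComps (suc s) (k ℕ.+ s)))
  lhsSum-∷ k ks F t = trans (posComps-antidiagonal _ (length ks) t) (antidiagonal-cong t step)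
    where
    step : ∀ s u → sumOver (λ ms → sumOver F (blocks (k ∷ ks) (suc s ∷ ms))) (posComps (length ks) (length ks ℕ.+ u))
         ≈ sumOver (λ a → lhsSum ks (F ∘ (a ++_)) u) (posComps (suc s) (k ℕ.+ s))
    step s u rewrite ℕₚ.+-suc k s = trans
      (sumOver-cong (λ ms → trans (sumOver-concatMap F _ (posComps (suc s) (k ℕ.+ s)))
                                  (sumOver-cong (λ a → sumOver-map F (a ++_) (blocks ks ms)) _)) _)
      (sumOver-swap (λ ms a → sumOver (F ∘ (a ++_)) (blocks ks ms)) _ _)

  -- Agreement is asked on nonempty indices only, because `ζ` and the sum of its `term`s differ at
  -- the empty index.
  lhsSum-cong-∷ : ∀ k ks t {F G} → (∀ a i → F (a ∷ i) ≈ G (a ∷ i)) → lhsSum (k ∷ ks) F t ≈ lhsSum (k ∷ ks) G t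
  lhsSum-cong-∷ k ks t {F} {G} F≗G = trans (lhsSum-∷ k ks F t)
    (trans (antidiagonal-cong t (λ s u → posComps-cong s (k ℕ.+ s) (λ j a → lhsSum-cong ks u (λ i → F≗G (suc j) (a ++ i)))))
           (sym (lhsSum-∷ k ks G t)))

  lhsSum-suc : ∀ k ks F t → lhsSum (suc k ∷ ks) F t
    ≈ antidiagonal t (λ s u → sumOver (λ a → lhsSum ks (λ i → F (1 ∷ a ++ i)) u) (posComps s (k ℕ.+ s)))
      + lhsSum (k ∷ ks) (F ∘ incrFirst) t
  lhsSum-suc k ks F t = trans (lhsSum-∷ (suc k) ks F t)
    (trans (antidiagonal-cong t (λ s u → posComps-split _ s (k ℕ.+ s)))
    (trans (antidiagonal-+ t _ _)
    (+-congˡ (trans (antidiagonal-cong t (λ s u → posComps-cong s (k ℕ.+ s) (λ j a → refl)))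
                        (sym (lhsSum-∷ k ks (F ∘ incrFirst) t))))))

  -- A block with k = 1 consists of ones. Removing the first one either exhausts the block or leaves
  -- a block of the same kind with t lowered by one.
  lhsSum-one : ∀ ks F t → lhsSum (1 ∷ ks) F t
    ≈ lhsSum ks (λ i → F (1 ∷ i)) t + shift (lhsSum (1 ∷ ks) (λ i → F (1 ∷ i))) t
  lhsSum-one ks F t = trans (lhsSum-suc 0 ks F t) (trans (+-cong (first t) (trans (lhsSum-∷ 0 ks _ t)
      (antidiagonal-0 t (λ s u → posComps-empty _ (ℕₚ.n<1+n s))))) (+-identityʳ _))
    where
    first : ∀ t → antidiagonal t (λ s u → sumOver (λ a → lhsSum ks (λ i → F (1 ∷ a ++ i)) u) (posComps s s))
          ≈ lhsSum ks (λ i → F (1 ∷ i)) t + shift (lhsSum (1 ∷ ks) (λ i → F (1 ∷ i))) t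
    first zero    = trans (sumOver-[-] _ []) (sym (+-identityʳ _))
    first (suc t) = +-cong (sumOver-[-] _ []) (sym (lhsSum-∷ 1 ks (λ i → F (1 ∷ i)) t))

  -- A first entry of at least 2 is lowered together with the weight parameter; a first entry 1 is
  -- removed, which keeps that parameter and lowers t. A block of a single entry cannot start with 1
  -- here, so the block is never exhausted.
  lhsSum-suc-suc : ∀ k ks F t → lhsSum (suc (suc k) ∷ ks) F t
    ≈ lhsSum (suc k ∷ ks) (F ∘ incrFirst) t + shift (lhsSum (suc (suc k) ∷ ks) (λ i → F (1 ∷ i))) t
  lhsSum-suc-suc k ks F t = trans (lhsSum-suc (suc k) ks F t) (trans (+-comm _ _) (+-congˡ (first t)))
    where
    first : ∀ t → antidiagonal t (λ s u → sumOver (λ a → lhsSum ks (λ i → F (1 ∷ a ++ i)) u) (posComps s (suc k ℕ.+ s)))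
          ≈ shift (lhsSum (suc (suc k) ∷ ks) (λ i → F (1 ∷ i))) t
    first zero    = sumOver-[] _
    first (suc t) = trans (+-congʳ (sumOver-[] _)) (trans (+-identityˡ _) (trans
      (antidiagonal-cong t (λ s u → idx-cong (λ w → sumOver (λ a → lhsSum ks (λ i → F (1 ∷ a ++ i)) u) (posComps (suc s) w)) (ℕₚ.+-suc (suc k) s)))
      (sym (lhsSum-∷ (suc (suc k)) ks (λ i → F (1 ∷ i)) t))))

  raise : List ℕ → (List ℕ → Carrier) → ℕ → Carrier
  raise idx F l = sumOver (λ e → F (zipWith ℕ._+_ idx e)) (weakComps (length idx) l)

  raise-cong-∷ : ∀ k idx l {F G} → (∀ a i → F (a ∷ i) ≈ G (a ∷ i)) → raise (k ∷ idx) F l ≈ raise (k ∷ idx) G l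
  raise-cong-∷ k idx l F≗G = weakComps-cong (length idx) l (λ j a → F≗G (k ℕ.+ j) (zipWith ℕ._+_ idx a))

  raise-zero : ∀ k idx F → raise (k ∷ idx) F 0 ≈ raise idx (λ i → F (k ∷ i)) 0
  raise-zero k idx F = trans (weakComps-zero (λ e → F (zipWith ℕ._+_ (k ∷ idx) e)) (length idx))
    (idx-cong (λ k → raise idx (λ i → F (k ∷ i)) 0) (ℕₚ.+-identityʳ k))

  raise-suc : ∀ k idx F l → raise (k ∷ idx) F (suc l) ≈ raise idx (λ i → F (k ∷ i)) (suc l) + raise (k ∷ idx) (F ∘ incrFirst) l
  raise-suc k idx F l = trans (weakComps-split (λ e → F (zipWith ℕ._+_ (k ∷ idx) e)) (length idx) l)
    (+-cong (idx-cong (λ k → raise idx (λ i → F (k ∷ i)) (suc l)) (ℕₚ.+-identityʳ k))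
               (weakComps-cong (length idx) l (λ j a → idx-cong (λ m → F (m ∷ zipWith ℕ._+_ idx a)) (ℕₚ.+-suc k j))))

  -- What follows the leading entry of `interleave (k ∷ ks) ms`: a run of ones stands before each
  -- entry of `ks`. The right-hand recursion alternates between such tails and indices with a fixed
  -- leading entry.
  onesThen : List ℕ → List ℕ → List ℕ
  onesThen ks []       = interleave ks []
  onesThen ks (m ∷ ms) = replicate m 1 ++ interleave ks ms

  interleave-∷ : ∀ k ks ms → interleave (k ∷ ks) ms ≡ k ∷ onesThen ks ms
  interleave-∷ k ks []       = ≡.refl
  interleave-∷ k ks (m ∷ ms) = ≡.refl

  rhsSum : ℕ → List ℕ → (List ℕ → Carrier) → ℕ → Carrier
  rhsSum k ks F t = antidiagonal t (λ l u → sumOver (λ ms → raise (k ∷ onesThen ks ms) F l) (weakComps (length ks) u))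

  onesSum : List ℕ → (List ℕ → Carrier) → ℕ → Carrier
  onesSum ks F t = antidiagonal t (λ l u → sumOver (λ ms → raise (onesThen ks ms) F l) (weakComps (length ks) u))

  rhsSum-cong-∷ : ∀ k ks t {F G} → (∀ a i → F (a ∷ i) ≈ G (a ∷ i)) → rhsSum k ks F t ≈ rhsSum k ks G t
  rhsSum-cong-∷ k ks t {F} {G} F≗G = antidiagonal-cong t (λ l u →
    sumOver-cong (λ ms → raise-cong-∷ k (onesThen ks ms) l {F} {G} F≗G) (weakComps (length ks) u))

  rhsSum-Σ< : ∀ k ks t n (F : ℕ → List ℕ → Carrier) → rhsSum k ks (λ i → Σ< n (λ l → F l i)) t ≈ Σ< n (λ l → rhsSum k ks (F l) t)
  rhsSum-Σ< k ks t n F = trans (antidiagonal-cong t (λ l u → trans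
      (sumOver-cong (λ ms → sumOver-Σ< n (λ j e → F j (zipWith ℕ._+_ (k ∷ onesThen ks ms) e)) _) _)
      (sumOver-Σ< n (λ j ms → raise (k ∷ onesThen ks ms) (F j) l) (weakComps (length ks) u))))
    (antidiagonal-Σ< t n _)

  *-rhsSum : ∀ k ks t c F → rhsSum k ks (λ i → c * F i) t ≈ c * rhsSum k ks F t
  *-rhsSum k ks t c F = trans (antidiagonal-cong t (λ l u → trans
      (sumOver-cong (λ ms → *-sumOver c (λ e → F (zipWith ℕ._+_ (k ∷ onesThen ks ms) e)) _) _)
      (*-sumOver c (λ ms → raise (k ∷ onesThen ks ms) F l) (weakComps (length ks) u))))
    (*-antidiagonal t c _)

  *-onesSum : ∀ ks t c F → onesSum ks (λ i → c * F i) t ≈ c * onesSum ks F t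
  *-onesSum ks t c F = trans (antidiagonal-cong t (λ l u → trans
      (sumOver-cong (λ ms → *-sumOver c (λ e → F (zipWith ℕ._+_ (onesThen ks ms) e)) _) _)
      (*-sumOver c (λ ms → raise (onesThen ks ms) F l) (weakComps (length ks) u))))
    (*-antidiagonal t c _)

  -- The first component of e is 0, which settles the leading entry, or it is positive and one unit
  -- of t goes into that entry.
  rhsSum-rec : ∀ k ks F t → rhsSum k ks F t ≈ onesSum ks (λ i → F (k ∷ i)) t + shift (rhsSum k ks (F ∘ incrFirst)) t
  rhsSum-rec k ks F t = antidiagonal-splitˡ t
    (λ u → sumOver-cong (λ ms → raise-zero k (onesThen ks ms) F) (weakComps (length ks) u))
    (λ l u → trans (sumOver-cong (λ ms → raise-suc k (onesThen ks ms) F l) (weakComps (length ks) u))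
                   (sumOver-+ (λ ms → raise (onesThen ks ms) (λ i → F (k ∷ i)) (suc l)) _ (weakComps (length ks) u)))

  -- The run before `k` is empty or begins with a 1. Since e may raise that 1 as well, it acts as a
  -- leading entry in its own right.
  onesSum-∷ : ∀ k ks F t → onesSum (k ∷ ks) F t ≈ rhsSum k ks F t + shift (rhsSum 1 (k ∷ ks) F) t
  onesSum-∷ k ks F t = antidiagonal-splitʳ t
    (λ l → trans (weakComps-zero (λ ms → raise (onesThen (k ∷ ks) ms) F l) (length ks)) (zeroth l 0))
    (λ l u → trans (weakComps-split (λ ms → raise (onesThen (k ∷ ks) ms) F l) (length ks) u)
      (+-cong (zeroth l (suc u)) (weakComps-cong (length ks) u (λ j a → refl))))
    where
    zeroth : ∀ l u → sumOver (λ ms → raise (interleave (k ∷ ks) ms) F l) (weakComps (length ks) u)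
                   ≈ sumOver (λ ms → raise (k ∷ onesThen ks ms) F l) (weakComps (length ks) u)
    zeroth l u = sumOver-cong (λ ms → idx-cong (λ i → raise i F l) (interleave-∷ k ks ms)) (weakComps (length ks) u)

  onesSum-[] : ∀ F t → onesSum [] F t ≈ const (F []) t
  onesSum-[] F zero    = trans (sumOver-[-] _ []) (sumOver-[-] _ [])
  onesSum-[] F (suc t) = trans (+-congʳ (sumOver-[] _)) (trans (+-identityˡ _) (antidiagonal-0 t zeros))
    where
    zeros : ∀ s u → sumOver (λ ms → raise (onesThen [] ms) F (suc s)) (weakComps 0 u) ≈ 0#
    zeros s zero    = trans (sumOver-[-] _ []) (sumOver-[] _)
    zeros s (suc u) = sumOver-[] _

  onesSum-cong-∷ : ∀ k ks t {F G} → (∀ a i → F (a ∷ i) ≈ G (a ∷ i)) → onesSum (k ∷ ks) F t ≈ onesSum (k ∷ ks) G t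
  onesSum-cong-∷ k ks t {F} {G} F≗G = trans (onesSum-∷ k ks F t)
    (trans (+-cong (rhsSum-cong-∷ k ks t {F} {G} F≗G) (shifted t)) (sym (onesSum-∷ k ks G t)))
    where
    shifted : ∀ t → shift (rhsSum 1 (k ∷ ks) F) t ≈ shift (rhsSum 1 (k ∷ ks) G) t
    shifted zero    = refl
    shifted (suc t) = rhsSum-cong-∷ 1 (k ∷ ks) t {F} {G} F≗G

  onesSum-Σ< : ∀ ks t n (F : ℕ → List ℕ → Carrier) → onesSum ks (λ i → Σ< n (λ l → F l i)) t ≈ Σ< n (λ l → onesSum ks (F l) t)
  onesSum-Σ< ks t n F = trans (antidiagonal-cong t (λ l u → trans
      (sumOver-cong (λ ms → sumOver-Σ< n (λ j e → F j (zipWith ℕ._+_ (onesThen ks ms) e)) _) _)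
      (sumOver-Σ< n (λ j ms → raise (onesThen ks ms) (F j) l) (weakComps (length ks) u))))
    (antidiagonal-Σ< t n _)

-- Generating series in x of the truncated sums.

module GeneratingSeries {a ℓ} (A : CommutativeRing a ℓ) where
  open CommutativeRing A
  open CauchyProduct A
  open IndexSums A
  open Exp semiring using (_^_)

  module K = CommutativeRing seqRing
  module KC = CauchyProduct seqRing
  open Exp K.semiring using () renaming (_^_ to _^ᴷ_)

  Σ<-pointwise : ∀ n (f : ℕ → Seq) t → KC.Σ< n f t ≈ Σ< n (λ l → f l t)
  Σ<-pointwise zero    f t = refl
  Σ<-pointwise (suc n) f t = +-congˡ (Σ<-pointwise n (f ∘ suc) t)

  shift-cong : ∀ {f g} → f ≋ g → shift f ≋ shift g
  shift-cong f≋g zero    = refl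
  shift-cong f≋g (suc t) = f≋g t

  *-shift : ∀ c f → shift (λ t → c * f t) ≋ (λ t → c * shift f t)
  *-shift c f zero    = sym (zeroʳ c)
  *-shift c f (suc t) = refl

  const-^-⊛ : ∀ c k f → (const c ^ᴷ k) ⊛ f ≋ (λ t → c ^ k * f t)
  const-^-⊛ c zero    f = const-⊛ 1# f
  const-^-⊛ c (suc k) f = K.trans (⊛-assoc (const c) (const c ^ᴷ k) f)
    (K.trans (const-⊛ c ((const c ^ᴷ k) ⊛ f)) (λ t → trans (*-congˡ (const-^-⊛ c k f t)) (sym (*-assoc _ _ _))))

  ι-const : ∀ n → KC.ι n ≋ const (ι n)
  ι-const zero    zero    = refl
  ι-const zero    (suc t) = refl
  ι-const (suc n) zero    = +-congˡ (ι-const n 0)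
  ι-const (suc n) (suc t) = trans (+-identityˡ _) (ι-const n (suc t))

  geometric : Carrier → Seq
  geometric c t = c ^ t

  X-const-⊛ : ∀ c f → X ⊛ const c ⊛ f ≋ shift (λ t → c * f t)
  X-const-⊛ c f = K.trans (⊛-assoc X (const c) f) (K.trans (X-⊛ (const c ⊛ f)) (shift-cong (const-⊛ c f)))

  module Zeta (v : ℕ → Carrier) (ι*v≈1 : ∀ n → ι (suc n) * v n ≈ 1#) where

    vᴷ pᴷ : ℕ → Seq
    vᴷ n = const (v n)
    pᴷ n = geometric (v n)

    ι*vᴷ≈1 : ∀ n → KC.ι (suc n) ⊛ vᴷ n ≋ const 1#
    ι*vᴷ≈1 n = K.trans (⊛-cong (ι-const (suc n)) K.refl)
      (K.trans (const-⊛ (ι (suc n)) (vᴷ n)) pointwise)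
      where
      pointwise : (λ t → ι (suc n) * vᴷ n t) ≋ const 1#
      pointwise zero    = ι*v≈1 n
      pointwise (suc t) = zeroʳ _

    pᴷ-unfold : ∀ n → pᴷ n ≋ (λ t → const 1# t + (X ⊛ vᴷ n ⊛ pᴷ n) t)
    pᴷ-unfold n t = trans (pointwise t) (+-congˡ (sym (X-const-⊛ (v n) (pᴷ n) t)))
      where
      pointwise : ∀ t → pᴷ n t ≈ const 1# t + shift (λ t → v n * pᴷ n t) t
      pointwise zero    = sym (+-identityʳ _)
      pointwise (suc t) = sym (+-identityˡ _)

    -- pᴷ n is the inverse of 1 - X v n.
    solve-geometric : ∀ n {y z} → y K.≈ z K.+ X K.* vᴷ n K.* y → y K.≈ pᴷ n K.* z
    solve-geometric n {y} {z} y≈ = RingProperties.+-cancelʳ K.ring (X K.* vᴷ n K.* pᴷ n K.* y) y (pᴷ n K.* z) (begin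
      y K.+ X K.* vᴷ n K.* pᴷ n K.* y          ≈⟨ solve 4 (λ y x v p → y :+ x :* v :* p :* y := (con 1 :+ x :* v :* p) :* y) K.refl y X (vᴷ n) (pᴷ n) ⟩
      (K.1# K.+ X K.* vᴷ n K.* pᴷ n) K.* y     ≈⟨ K.*-congʳ {y} (pᴷ-unfold n) ⟨
      pᴷ n K.* y                               ≈⟨ K.*-congˡ {pᴷ n} y≈ ⟩
      pᴷ n K.* (z K.+ X K.* vᴷ n K.* y)        ≈⟨ solve 5 (λ y x v p z → p :* (z :+ x :* v :* y) := p :* z :+ x :* v :* p :* y) K.refl y X (vᴷ n) (pᴷ n) z ⟩
      pᴷ n K.* z K.+ X K.* vᴷ n K.* pᴷ n K.* y ∎)
      where
      open SetoidReasoning K.setoid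
      open SemiringSolver K.commutativeSemiring using (solve; _:+_; _:*_; _:=_; con)

    -- ζ n is zetaTr (suc n), and term n is its summand with largest variable n + 1.
    ζ : ℕ → List ℕ → Carrier
    ζ n []       = 1#
    ζ n (k ∷ ks) = Σ< n (λ l → v l ^ k * ζ l ks)

    term : ℕ → List ℕ → Carrier
    term n []       = 0#
    term n (k ∷ ks) = v n ^ k * ζ n ks

    term-1∷ : ∀ n i → term n (1 ∷ i) ≈ v n * ζ n i
    term-1∷ n i = *-congʳ (*-identityʳ (v n))

    term-incrFirst : ∀ n i → term n (incrFirst i) ≈ v n * term n i
    term-incrFirst n []      = sym (zeroʳ _)
    term-incrFirst n (k ∷ i) = *-assoc _ _ _

    ζ⁺ : ℕ → List ℕ → Carrier
    ζ⁺ n i = ζ n (incrFirst i)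

    ζ⁺-∷ : ∀ n k i → ζ⁺ n (k ∷ i) ≈ Σ< n (λ l → v l * term l (k ∷ i))
    ζ⁺-∷ n k i = Σ<-cong n (λ l → term-incrFirst l (k ∷ i))

    G H : ℕ → List ℕ → ℕ → Seq
    G k ks n = lhsSum (suc k ∷ map suc ks) (term n)
    H k ks n = rhsSum (suc k) (map suc ks) (term n)

    D O : List ℕ → ℕ → Seq
    D ks n = lhsSum (map suc ks) (ζ n)
    O ks n = onesSum (map suc ks) (ζ n)

    D-[] : ∀ n → D [] n ≋ const 1#
    D-[] n zero    = trans (sumOver-[-] _ []) (sumOver-[-] _ [])
    D-[] n (suc t) = sumOver-[] _

    D-∷ : ∀ k ks n → D (k ∷ ks) n ≋ KC.Σ< n (G k ks)
    D-∷ k ks n t = trans (lhsSum-cong-∷ (suc k) (map suc ks) t {ζ n} {λ i → Σ< n (λ l → term l i)} (λ a i → refl))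
      (trans (lhsSum-Σ< (suc k ∷ map suc ks) t n term) (sym (Σ<-pointwise n (G k ks) t)))

    lhsSum-1∷ : ∀ ks n t → lhsSum ks (λ i → term n (1 ∷ i)) t ≈ v n * lhsSum ks (ζ n) t
    lhsSum-1∷ ks n t = trans (lhsSum-cong ks t (term-1∷ n)) (*-lhsSum ks t (v n) (ζ n))

    const-⊛-+X : ∀ c (f g : Seq) t → c * f t + shift (λ t → c * g t) t ≈ (const c ⊛ (λ t → f t + (X ⊛ g) t)) t
    const-⊛-+X c f g t = trans (+-congˡ (trans (*-shift c g t) (*-congˡ (sym (X-⊛ g t)))))
      (trans (sym (distribˡ c (f t) ((X ⊛ g) t))) (sym (const-⊛ c (λ t → f t + (X ⊛ g) t) t)))

    G-zero : ∀ ks n → G 0 ks n ≋ vᴷ n ⊛ (λ t → D ks n t + (X ⊛ D (0 ∷ ks) n) t)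
    G-zero ks n t = trans (lhsSum-one (map suc ks) (term n) t)
      (trans (+-cong (lhsSum-1∷ (map suc ks) n t) (shift-cong (lhsSum-1∷ (1 ∷ map suc ks) n) t))
             (const-⊛-+X (v n) (D ks n) (D (0 ∷ ks) n) t))

    G-suc : ∀ k ks n → G (suc k) ks n ≋ vᴷ n ⊛ (λ t → G k ks n t + (X ⊛ D (suc k ∷ ks) n) t)
    G-suc k ks n t = trans (lhsSum-suc-suc k (map suc ks) (term n) t)
      (trans (+-cong (trans (lhsSum-cong (suc k ∷ map suc ks) t (term-incrFirst n)) (*-lhsSum (suc k ∷ map suc ks) t (v n) (term n)))
                     (shift-cong (lhsSum-1∷ (suc (suc k) ∷ map suc ks) n) t))
             (const-⊛-+X (v n) (G k ks n) (D (suc k ∷ ks) n) t))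

    -- Raising the leading exponent by every amount produces the geometric series of X v n;
    -- `rhsSum-rec` is the equation y = z + X v y.
    rhsSum-term : ∀ k ks n → rhsSum k ks (term n) ≋ pᴷ n ⊛ (λ t → v n ^ k * onesSum ks (ζ n) t)
    rhsSum-term k ks n = solve-geometric n (λ t → trans (rhsSum-rec k ks (term n) t)
      (+-cong (*-onesSum ks t (v n ^ k) (ζ n)) (trans (shift-cong raised t) (sym (X-const-⊛ (v n) (rhsSum k ks (term n)) t)))))
      where
      raised : ∀ t → rhsSum k ks (term n ∘ incrFirst) t ≈ v n * rhsSum k ks (term n) t
      raised t = trans (rhsSum-cong-∷ k ks t {term n ∘ incrFirst} {λ i → v n * term n i} (λ a i → term-incrFirst n (a ∷ i)))
                       (*-rhsSum k ks t (v n) (term n))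

    H-rec : ∀ k ks n → H k ks n ≋ (vᴷ n ^ᴷ suc k) ⊛ (pᴷ n ⊛ O ks n)
    H-rec k ks n t = trans (rhsSum-term (suc k) (map suc ks) n t)
      (trans (⊛-*ʳ (v n ^ suc k) (pᴷ n) (O ks n) t) (sym (const-^-⊛ (v n) (suc k) (pᴷ n ⊛ O ks n) t)))

    O-[] : ∀ n → O [] n ≋ const 1#
    O-[] n = onesSum-[] (ζ n)

    O-∷ : ∀ k ks n t → O (k ∷ ks) n t ≈ Σ< n (λ l → onesSum (suc k ∷ map suc ks) (term l) t)
    O-∷ k ks n t = trans (onesSum-cong-∷ (suc k) (map suc ks) t {ζ n} {λ i → Σ< n (λ l → term l i)} (λ a i → refl))
      (onesSum-Σ< (suc k ∷ map suc ks) t n term)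

    O-zero : ∀ k ks → O (k ∷ ks) 0 ≋ (λ _ → 0#)
    O-zero k ks = O-∷ k ks 0

    -- Terms with the new largest variable start at `k`, giving `H`, or at an inserted 1, giving X v
    -- p O; and O + X v p O = p O.
    O-suc : ∀ k ks n → O (k ∷ ks) (suc n) ≋ (λ t → (pᴷ n ⊛ O (k ∷ ks) n) t + H k ks n t)
    O-suc k ks n t = begin
      o (suc n) t
        ≈⟨ trans (O-∷ k ks (suc n) t) (trans (Σ<-last n _) (+-congʳ (sym (O-∷ k ks n t)))) ⟩
      o n t + onesSum (suc k ∷ map suc ks) (term n) t
        ≈⟨ +-congˡ (onesSum-∷ (suc k) (map suc ks) (term n) t) ⟩
      o n t + (H k ks n t + shift (rhsSum 1 (suc k ∷ map suc ks) (term n)) t)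
        ≈⟨ +-congˡ (+-congˡ (shift-cong inserted t)) ⟩
      o n t + (H k ks n t + shift (λ t → v n * (pᴷ n ⊛ o n) t) t)
        ≈⟨ solve 3 (λ p q r → p :+ (q :+ r) := p :+ r :+ q) refl _ _ _ ⟩
      o n t + shift (λ t → v n * (pᴷ n ⊛ o n) t) t + H k ks n t
        ≈⟨ +-congʳ geometric-step ⟩
      (pᴷ n ⊛ o n) t + H k ks n t ∎
      where
      open SetoidReasoning setoid
      open SemiringSolver commutativeSemiring using (solve; _:+_; _:=_)
      o = O (k ∷ ks)
      inserted : ∀ t → rhsSum 1 (suc k ∷ map suc ks) (term n) t ≈ v n * (pᴷ n ⊛ o n) t
      inserted t = trans (rhsSum-term 1 (suc k ∷ map suc ks) n t)
        (trans (⊛-*ʳ (v n ^ 1) (pᴷ n) (o n) t) (*-congʳ (*-identityʳ (v n))))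
      geometric-step : o n t + shift (λ t → v n * (pᴷ n ⊛ o n) t) t ≈ (pᴷ n ⊛ o n) t
      geometric-step = sym (trans (K.*-congʳ {o n} (pᴷ-unfold n) t)
        (trans (⊛-distribʳ (o n) (const 1#) (X ⊛ vᴷ n ⊛ pᴷ n) t)
        (+-cong (K.*-identityˡ (o n) t)
                (trans (⊛-assoc (X ⊛ vᴷ n) (pᴷ n) (o n) t) (X-const-⊛ (v n) (pᴷ n ⊛ o n) t)))))

    private module T = Transport seqRing

    b c : ℕ → Seq
    b = T.b X vᴷ pᴷ ι*vᴷ≈1 pᴷ-unfold
    c = T.c X vᴷ pᴷ ι*vᴷ≈1 pᴷ-unfold

    κ : ℕ → ℕ → Seq
    κ = T.κ X vᴷ pᴷ ι*vᴷ≈1 pᴷ-unfold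

    -- The outer factor `v l` is the extra unit in the first argument of ζ⁺; it is the weight under
    -- which `transport` compares the two sides.
    rhs≈lhs+remainder : ∀ k ks M t → rhsSum (suc k) (map suc ks) (ζ⁺ M) t
      ≈ lhsSum (suc k ∷ map suc ks) (ζ⁺ M) t + Σ< M (λ m → v m * (H k ks m ⊛ κ m (M ∸ m)) t)
    rhs≈lhs+remainder k ks M t = begin
      rhsSum (suc k) (map suc ks) (ζ⁺ M) t
        ≈⟨ rhsSum-cong-∷ (suc k) (map suc ks) t {ζ⁺ M} {λ i → Σ< M (λ l → v l * term l i)} (ζ⁺-∷ M) ⟩
      rhsSum (suc k) (map suc ks) (λ i → Σ< M (λ l → v l * term l i)) t
        ≈⟨ rhsSum-Σ< (suc k) (map suc ks) t M (λ l i → v l * term l i) ⟩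
      Σ< M (λ l → rhsSum (suc k) (map suc ks) (λ i → v l * term l i) t)
        ≈⟨ Σ<-cong M (λ l → trans (*-rhsSum (suc k) (map suc ks) t (v l) (term l)) (sym (const-⊛ (v l) (H k ks l) t))) ⟩
      Σ< M (λ l → (vᴷ l ⊛ H k ks l) t)
        ≈⟨ Σ<-pointwise M (λ l → vᴷ l ⊛ H k ks l) t ⟨
      KC.Σ< M (λ l → vᴷ l ⊛ H k ks l) t
        ≈⟨ T.transport X vᴷ pᴷ ι*vᴷ≈1 pᴷ-unfold G D H O D-[] D-∷ G-zero G-suc O-[] O-zero O-suc H-rec k ks M t ⟩
      KC.Σ< M (λ l → vᴷ l ⊛ G k ks l) t + KC.Σ< M (λ m → vᴷ m ⊛ H k ks m ⊛ κ m (M ∸ m)) t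
        ≈⟨ +-cong (Σ<-pointwise M (λ l → vᴷ l ⊛ G k ks l) t) (Σ<-pointwise M (λ m → vᴷ m ⊛ H k ks m ⊛ κ m (M ∸ m)) t) ⟩
      Σ< M (λ l → (vᴷ l ⊛ G k ks l) t) + Σ< M (λ m → (vᴷ m ⊛ H k ks m ⊛ κ m (M ∸ m)) t)
        ≈⟨ +-cong (Σ<-cong M (λ l → trans (const-⊛ (v l) (G k ks l) t) (sym (*-lhsSum (suc k ∷ map suc ks) t (v l) (term l)))))
                  (Σ<-cong M (λ m → trans (⊛-assoc (vᴷ m) (H k ks m) (κ m (M ∸ m)) t) (const-⊛ (v m) (H k ks m ⊛ κ m (M ∸ m)) t))) ⟩
      Σ< M (λ l → lhsSum (suc k ∷ map suc ks) (λ i → v l * term l i) t) + Σ< M (λ m → v m * (H k ks m ⊛ κ m (M ∸ m)) t)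
        ≈⟨ +-congʳ (lhsSum-Σ< (suc k ∷ map suc ks) t M (λ l i → v l * term l i)) ⟨
      lhsSum (suc k ∷ map suc ks) (λ i → Σ< M (λ l → v l * term l i)) t + Σ< M (λ m → v m * (H k ks m ⊛ κ m (M ∸ m)) t)
        ≈⟨ +-congʳ (lhsSum-cong-∷ (suc k) (map suc ks) t {ζ⁺ M} {λ i → Σ< M (λ l → v l * term l i)} (ζ⁺-∷ M)) ⟨
      lhsSum (suc k ∷ map suc ks) (ζ⁺ M) t + Σ< M (λ m → v m * (H k ks m ⊛ κ m (M ∸ m)) t) ∎
      where open SetoidReasoning setoid

-- Powers of two against powers of logarithms.

-- This is 2^k - 1, because `v` is indexed from 0: the indices from `dyadic k` up to
-- `dyadic (suc k)` form a block of 2^k reciprocals, the largest being 2^(-k).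
dyadic : ℕ → ℕ
dyadic zero    = 0
dyadic (suc k) = dyadic k ℕ.+ suc (dyadic k)

suc-dyadic : ∀ k → suc (dyadic k) ≡ 2 ℕ.^ k
suc-dyadic zero    = ≡.refl
suc-dyadic (suc k) = ≡.trans (≡.cong₂ ℕ._+_ (suc-dyadic k) (suc-dyadic k))
  (≡.cong (2 ℕ.^ k ℕ.+_) (≡.sym (ℕₚ.+-identityʳ (2 ℕ.^ k))))

dyadic-step : ∀ k → dyadic k ℕ.< dyadic (suc k)
dyadic-step k = ≡.subst (dyadic k ℕ.<_) (≡.sym (ℕₚ.+-suc (dyadic k) (dyadic k))) (s≤s (ℕₚ.m≤m+n (dyadic k) (dyadic k)))

dyadic-mono : ∀ {i k} → i ℕ.≤ k → dyadic i ℕ.≤ dyadic k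
dyadic-mono {i} i≤k with ℕₚ.m≤n⇒∃[o]m+o≡n i≤k
... | d , ≡.refl = go d
  where
  go : ∀ d → dyadic i ℕ.≤ dyadic (i ℕ.+ d)
  go zero    = ℕₚ.≤-reflexive (≡.cong dyadic (≡.sym (ℕₚ.+-identityʳ i)))
  go (suc d) = ℕₚ.≤-trans (go d) (≡.subst (λ k → dyadic (i ℕ.+ d) ℕ.≤ dyadic k) (≡.sym (ℕₚ.+-suc i d)) (ℕₚ.<⇒≤ (dyadic-step (i ℕ.+ d))))

dyadic-bracket : ∀ n → ∃ λ k → dyadic k ℕ.≤ n × n ℕ.< dyadic (suc k)
dyadic-bracket zero    = 0 , z≤n , s≤s z≤n
dyadic-bracket (suc n) with dyadic-bracket n
... | k , lo , hi with ℕₚ.m≤n⇒m<n∨m≡n hi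
...   | inj₁ lt = k , ℕₚ.m≤n⇒m≤1+n lo , lt
...   | inj₂ eq = suc k , ℕₚ.≤-reflexive (≡.sym eq) , ≡.subst (ℕ._< dyadic (suc (suc k))) (≡.sym eq) (dyadic-step (suc k))

n<2^n : ∀ n → n ℕ.< 2 ℕ.^ n
n<2^n zero    = s≤s z≤n
n<2^n (suc n) = ℕₚ.≤-trans (ℕₚ.+-mono-≤ (ℕₚ.m^n>0 2 n) (n<2^n n))
  (ℕₚ.≤-reflexive (≡.cong (2 ℕ.^ n ℕ.+_) (≡.sym (ℕₚ.+-identityʳ (2 ℕ.^ n)))))

-- The inequality 3 (2 + j) ≤ 2^j for j = 5 + i; it fails at j = 4.
3*[7+i]≤2^[5+i] : ∀ i → 3 ℕ.* (7 ℕ.+ i) ℕ.≤ 2 ℕ.^ (5 ℕ.+ i)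
3*[7+i]≤2^[5+i] zero    = ℕₚ.m≤m+n 21 11
3*[7+i]≤2^[5+i] (suc i) = begin
  3 ℕ.* (7 ℕ.+ suc i)                       ≡⟨ ≡.cong (3 ℕ.*_) (ℕₚ.+-suc 7 i) ⟩
  3 ℕ.* (suc (7 ℕ.+ i))                     ≡⟨ ℕₚ.*-suc 3 (7 ℕ.+ i) ⟩
  3 ℕ.+ 3 ℕ.* (7 ℕ.+ i)                     ≤⟨ ℕₚ.+-mono-≤ (ℕₚ.≤-trans (ℕₚ.m≤m*n 3 (7 ℕ.+ i)) (3*[7+i]≤2^[5+i] i)) (3*[7+i]≤2^[5+i] i) ⟩
  2 ℕ.^ (5 ℕ.+ i) ℕ.+ 2 ℕ.^ (5 ℕ.+ i)       ≡⟨ ≡.cong (2 ℕ.^ (5 ℕ.+ i) ℕ.+_) (ℕₚ.+-identityʳ (2 ℕ.^ (5 ℕ.+ i))) ⟨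
  2 ℕ.^ (5 ℕ.+ suc i) ∎
  where open ℕₚ.≤-Reasoning

halve : ∀ k → ∃ λ j → 2 ℕ.* j ℕ.≤ k × k ℕ.≤ suc (2 ℕ.* j)
halve zero    = 0 , z≤n , z≤n
halve (suc k) with halve k
... | j , lo , hi with ℕₚ.m≤n⇒m<n∨m≡n hi
...   | inj₁ lt = j , ℕₚ.m≤n⇒m≤1+n lo , lt
...   | inj₂ eq = suc j , ℕₚ.≤-reflexive (≡.trans (ℕₚ.*-suc 2 j) (≡.cong suc (≡.sym eq)))
                        , ℕₚ.≤-trans (ℕₚ.≤-reflexive (≡.cong suc eq)) (ℕₚ.≤-trans (ℕₚ.≤-reflexive (≡.sym (ℕₚ.*-suc 2 j))) (ℕₚ.n≤1+n _))

^-distribʳ-* : ∀ m n d → (m ℕ.* n) ℕ.^ d ≡ m ℕ.^ d ℕ.* n ℕ.^ d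
^-distribʳ-* m n zero    = ≡.refl
^-distribʳ-* m n (suc d) = ≡.trans (≡.cong (m ℕ.* n ℕ.*_) (^-distribʳ-* m n d))
  (solve 4 (λ m n p q → m :* n :* (p :* q) := m :* p :* (n :* q)) ≡.refl m n (m ℕ.^ d) (n ℕ.^ d))
  where open SemiringSolver ℕₚ.+-*-commutativeSemiring using (solve; _:*_; _:=_)

-- Doubling the exponent squares the right-hand side, which pays for one more factor on the left.
2^-dominates : ∀ d C → ∃ λ k₀ → ∀ k → k₀ ℕ.≤ k → C ℕ.* (3 ℕ.* (2 ℕ.+ k)) ℕ.^ d ℕ.≤ 2 ℕ.^ k
2^-dominates zero    C = C , λ k C≤k → ℕₚ.≤-trans (ℕₚ.≤-reflexive (ℕₚ.*-identityʳ C)) (ℕₚ.≤-trans C≤k (ℕₚ.<⇒≤ (n<2^n k)))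
-- The factor 2^(d+1) pays for replacing 3 (2 + k) by 2 Y, where j is half of k.
2^-dominates (suc d) C with 2^-dominates d (C ℕ.* 2 ℕ.^ suc d)
-- An odd threshold, so that k ≤ 2 j + 1 still gives j ≥ 5 + j₀: the 5 serves Y ≤ 2^j, and j₀ the
-- inductive bound.
... | j₀ , bound = suc (2 ℕ.* (5 ℕ.+ j₀)) , go
  where
  open ℕₚ.≤-Reasoning
  go : ∀ k → suc (2 ℕ.* (5 ℕ.+ j₀)) ℕ.≤ k → C ℕ.* (3 ℕ.* (2 ℕ.+ k)) ℕ.^ suc d ℕ.≤ 2 ℕ.^ k
  go k k₀≤k with halve k
  ... | j , lo , hi = begin
    C ℕ.* (3 ℕ.* (2 ℕ.+ k)) ℕ.^ suc d
      ≤⟨ ℕₚ.*-monoʳ-≤ C (ℕₚ.^-monoˡ-≤ (suc d) 3[2+k]≤2Y) ⟩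
    C ℕ.* (2 ℕ.* Y) ℕ.^ suc d
      ≡⟨ ≡.cong (C ℕ.*_) (^-distribʳ-* 2 Y (suc d)) ⟩
    C ℕ.* (2 ℕ.^ suc d ℕ.* (Y ℕ.* Y ℕ.^ d))
      ≡⟨ solve 4 (λ c e y z → c :* (e :* (y :* z)) := c :* e :* z :* y) ≡.refl C (2 ℕ.^ suc d) Y (Y ℕ.^ d) ⟩
    C ℕ.* 2 ℕ.^ suc d ℕ.* Y ℕ.^ d ℕ.* Y
      ≤⟨ ℕₚ.*-mono-≤ (bound j (ℕₚ.≤-trans (ℕₚ.m≤n+m j₀ 5) 5+j₀≤j)) Y≤2^j ⟩
    2 ℕ.^ j ℕ.* 2 ℕ.^ j
      ≡⟨ ℕₚ.^-distribˡ-+-* 2 j j ⟨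
    2 ℕ.^ (j ℕ.+ j)
      ≤⟨ ℕₚ.^-monoʳ-≤ 2 (ℕₚ.≤-trans (ℕₚ.≤-reflexive (≡.cong (j ℕ.+_) (≡.sym (ℕₚ.+-identityʳ j)))) lo) ⟩
    2 ℕ.^ k ∎
    where
    open SemiringSolver ℕₚ.+-*-commutativeSemiring using (solve; _:*_; _:+_; con; _:=_)
    Y = 3 ℕ.* (2 ℕ.+ j)
    5+j₀≤j : 5 ℕ.+ j₀ ℕ.≤ j
    5+j₀≤j = ℕₚ.*-cancelˡ-≤ 2 (ℕₚ.≤-pred (ℕₚ.≤-trans k₀≤k hi))
    3[2+k]≤2Y : 3 ℕ.* (2 ℕ.+ k) ℕ.≤ 2 ℕ.* Y
    3[2+k]≤2Y = begin
      3 ℕ.* (2 ℕ.+ k)                 ≤⟨ ℕₚ.*-monoʳ-≤ 3 (ℕₚ.+-monoʳ-≤ 2 (ℕₚ.≤-trans hi (ℕₚ.n≤1+n _))) ⟩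
      3 ℕ.* (2 ℕ.+ (2 ℕ.+ 2 ℕ.* j))   ≡⟨ solve 1 (λ j → con 3 :* (con 2 :+ (con 2 :+ con 2 :* j)) := con 2 :* (con 3 :* (con 2 :+ j))) ≡.refl j ⟩
      2 ℕ.* Y ∎
    Y≤2^j : Y ℕ.≤ 2 ℕ.^ j
    Y≤2^j with ℕₚ.m≤n⇒∃[o]m+o≡n (ℕₚ.≤-trans (ℕₚ.m≤m+n 5 j₀) 5+j₀≤j)
    ... | i , ≡.refl = 3*[7+i]≤2^[5+i] i

-- Majorant series and the decay of the remainder.

module Majorants {a ℓ} (A : CommutativeRing a ℓ) where
  open CommutativeRing A
  open CauchyProduct A
  open GeneratingSeries A
  open Exp semiring using (_^_)
  open SemiringSolver commutativeSemiring using (solve; _:+_; _:*_; _:=_; con)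

  -- x ⊴ y is an abstraction of ∣x∣ ≤ y, so that x ⊴ x says that x is nonnegative.
  module _ {r} (_⊴_ : Carrier → Carrier → Set r)
           (⊴-resp : ∀ {x x′ y y′} → x ≈ x′ → y ≈ y′ → x ⊴ y → x′ ⊴ y′)
           (⊴-trans : ∀ {x y z} → x ⊴ y → y ⊴ z → x ⊴ z)
           (+-⊴ : ∀ {x x′ y y′} → x ⊴ y → x′ ⊴ y′ → (x + x′) ⊴ (y + y′))
           (*-⊴ : ∀ {x x′ y y′} → x ⊴ y → x′ ⊴ y′ → (x * x′) ⊴ (y * y′))
           (neg-⊴ : ∀ {x y} → x ⊴ y → (- x) ⊴ y)
           (0⊴0 : 0# ⊴ 0#) (1⊴1 : 1# ⊴ 1#) (0⊴ : ∀ {x} → x ⊴ x → 0# ⊴ x)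
           (v : ℕ → Carrier) (ι*v≈1 : ∀ n → ι (suc n) * v n ≈ 1#) (v⊴v : ∀ n → v n ⊴ v n) where

    open Zeta v ι*v≈1

    ⊴-respˡ : ∀ {x x′ y} → x ≈ x′ → x ⊴ y → x′ ⊴ y
    ⊴-respˡ e = ⊴-resp e refl

    ⊴-respʳ : ∀ {x y y′} → y ≈ y′ → x ⊴ y → x ⊴ y′
    ⊴-respʳ e = ⊴-resp refl e

    ⊴-+ʳ : ∀ {x y z} → x ⊴ y → z ⊴ z → x ⊴ (y + z)
    ⊴-+ʳ x⊴y z⊴z = ⊴-respˡ (+-identityʳ _) (+-⊴ x⊴y (0⊴ z⊴z))

    ⊴-+ˡ : ∀ {x y z} → x ⊴ y → z ⊴ z → x ⊴ (z + y)
    ⊴-+ˡ x⊴y z⊴z = ⊴-respʳ (+-comm _ _) (⊴-+ʳ x⊴y z⊴z)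

    Σ<-⊴ : ∀ n {f g} → (∀ i → i ℕ.< n → f i ⊴ g i) → Σ< n f ⊴ Σ< n g
    Σ<-⊴ zero    f⊴g = 0⊴0
    Σ<-⊴ (suc n) f⊴g = +-⊴ (f⊴g 0 (s≤s z≤n)) (Σ<-⊴ n (λ i i<n → f⊴g (suc i) (s≤s i<n)))

    ^-⊴ : ∀ t {x y} → x ⊴ y → (x ^ t) ⊴ (y ^ t)
    ^-⊴ zero    x⊴y = 1⊴1
    ^-⊴ (suc t) x⊴y = *-⊴ x⊴y (^-⊴ t x⊴y)

    infix 4 _≼_
    _≼_ : Seq → Seq → Set r
    f ≼ g = ∀ t → f t ⊴ g t

    ⊛-≼ : ∀ {f f′ g g′} → f ≼ f′ → g ≼ g′ → f ⊛ g ≼ f′ ⊛ g′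
    ⊛-≼ p q zero    = *-⊴ (p 0) (q 0)
    ⊛-≼ p q (suc t) = +-⊴ (*-⊴ (p 0) (q (suc t))) (⊛-≼ (p ∘ suc) q t)

    shift-≼ : ∀ {f g} → f ≼ g → shift f ≼ shift g
    shift-≼ p zero    = 0⊴0
    shift-≼ p (suc t) = p t

    infixr 8 _·geo_
    -- The coefficients of w/(1 - e X). Products of such series are majorised by one of the same
    -- form, so an estimate in all degrees is tracked by two numbers.
    _·geo_ : Carrier → Carrier → Seq
    (w ·geo e) t = w * e ^ t

    ·geo-≼ : ∀ {w w′ e e′} → w ⊴ w′ → e ⊴ e′ → w ·geo e ≼ w′ ·geo e′
    ·geo-≼ w⊴ e⊴ t = *-⊴ w⊴ (^-⊴ t e⊴)

    const-1-≼ : ∀ {e} → e ⊴ e → const 1# ≼ 1# ·geo e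
    const-1-≼ e⊴e zero    = ⊴-respʳ (sym (*-identityˡ _)) 1⊴1
    const-1-≼ e⊴e (suc t) = 0⊴ (*-⊴ 1⊴1 (^-⊴ (suc t) e⊴e))

    -- A factor 1 + q X is absorbed by enlarging e to e + q; a product of factors 1 ± X/i thereby
    -- leads to a harmonic number.
    geo-step : ∀ {e q} → e ⊴ e → q ⊴ q → ∀ t → (e ^ t + shift (λ t → q * e ^ t) t) ⊴ ((e + q) ^ t)
    geo-step e⊴e q⊴q zero    = ⊴-respˡ (sym (+-identityʳ _)) 1⊴1
    geo-step {e} {q} e⊴e q⊴q (suc t) = ⊴-respˡ (distribʳ _ _ _) (*-⊴ (+-⊴ e⊴e q⊴q) (^-⊴ t (⊴-+ʳ e⊴e q⊴q)))

    -- The left-hand coefficients are binomial expansions with the binomial coefficients replaced by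
    -- 1.
    geo-⊛ : ∀ {d e} → d ⊴ d → e ⊴ e → geometric d ⊛ geometric e ≼ geometric (d + e)
    geo-⊛ d⊴d e⊴e zero    = ⊴-respˡ (sym (*-identityˡ _)) 1⊴1
    geo-⊛ {d} {e} d⊴d e⊴e (suc t) = ⊴-resp
      (+-cong (sym (*-identityˡ _)) (sym (⊛-*ˡ d (d ^_) (e ^_) t)))
      (trans (+-comm _ _) (sym (distribʳ _ _ _)))
      (+-⊴ (*-⊴ e⊴e (^-⊴ t (⊴-+ˡ e⊴e d⊴d))) (*-⊴ d⊴d (geo-⊛ d⊴d e⊴e t)))

    ·geo-⊛ : ∀ {w w′ d e} → w ⊴ w → w′ ⊴ w′ → d ⊴ d → e ⊴ e → w ·geo d ⊛ w′ ·geo e ≼ (w * w′) ·geo (d + e)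
    ·geo-⊛ {w} {w′} {d} {e} w⊴w w′⊴w′ d⊴d e⊴e t = ⊴-respˡ
      (sym (trans (⊛-*ˡ w (d ^_) (w′ ·geo e) t) (trans (*-congˡ (⊛-*ʳ w′ (d ^_) (e ^_) t)) (sym (*-assoc _ _ _)))))
      (*-⊴ (*-⊴ w⊴w w′⊴w′) (geo-⊛ d⊴d e⊴e t))

    ι⊴ι : ∀ n → ι n ⊴ ι n
    ι⊴ι zero    = 0⊴0
    ι⊴ι (suc n) = +-⊴ 1⊴1 (ι⊴ι n)

    ι-mono : ∀ {m n} → m ℕ.≤ n → ι m ⊴ ι n
    ι-mono {n = n} z≤n = 0⊴ (ι⊴ι n)
    ι-mono (s≤s m≤n)   = +-⊴ 1⊴1 (ι-mono m≤n)

    ι-* : ∀ m n → ι (m ℕ.* n) ≈ ι m * ι n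
    ι-* zero    n = sym (zeroˡ _)
    ι-* (suc m) n = trans (ι-+ n (m ℕ.* n)) (trans (+-cong (sym (*-identityˡ _)) (ι-* m n)) (sym (distribʳ _ _ _)))

    ι-^ : ∀ n d → ι (n ℕ.^ d) ≈ ι n ^ d
    ι-^ n zero    = +-identityʳ 1#
    ι-^ n (suc d) = trans (ι-* n (n ℕ.^ d)) (*-congˡ (ι-^ n d))

    v-bound : ∀ k m n → suc k ℕ.* m ℕ.≤ suc n → (ι m * v n) ⊴ v k
    v-bound k m n le = ⊴-resp lhs (*-identityʳ (v k)) (*-⊴ (v⊴v k) (⊴-respʳ (ι*v≈1 n) (*-⊴ (ι-mono le) (v⊴v n))))
      where
      lhs : v k * (ι (suc k ℕ.* m) * v n) ≈ ι m * v n
      lhs = trans (*-congˡ (*-congʳ (ι-* (suc k) m)))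
        (trans (solve 4 (λ p q r s → p :* (q :* r :* s) := q :* p :* (r :* s)) refl (v k) (ι (suc k)) (ι m) (v n))
        (trans (*-congʳ (ι*v≈1 k)) (*-identityˡ _)))

    v-anti : ∀ {m n} → m ℕ.≤ n → v n ⊴ v m
    v-anti {m} {n} m≤n = ⊴-respˡ (trans (*-congʳ (+-identityʳ 1#)) (*-identityˡ (v n)))
      (v-bound m 1 n (s≤s (ℕₚ.≤-trans (ℕₚ.≤-reflexive (ℕₚ.*-identityʳ m)) m≤n)))

    v0≈1 : v 0 ≈ 1#
    v0≈1 = trans (sym (trans (*-congʳ (+-identityʳ 1#)) (*-identityˡ (v 0)))) (ι*v≈1 0)

    v⊴1 : ∀ n → v n ⊴ 1#
    v⊴1 n = ⊴-respʳ v0≈1 (v-anti z≤n)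

    -- One plus the n-th harmonic number; the initial 1 makes room for the factor X in `b 1`.
    E : ℕ → Carrier
    E zero    = 1#
    E (suc n) = E n + v n

    E⊴E : ∀ n → E n ⊴ E n
    E⊴E zero    = 1⊴1
    E⊴E (suc n) = +-⊴ (E⊴E n) (v⊴v n)

    E-mono : ∀ {m n} → m ℕ.≤ n → E m ⊴ E n
    E-mono {m} m≤n with ℕₚ.m≤n⇒∃[o]m+o≡n m≤n
    ... | d , ≡.refl = go d
      where
      go : ∀ d → E m ⊴ E (m ℕ.+ d)
      go zero    = ⊴-respʳ (reflexive (≡.cong E (≡.sym (ℕₚ.+-identityʳ m)))) (E⊴E m)
      go (suc d) = ⊴-respʳ (reflexive (≡.cong E (≡.sym (ℕₚ.+-suc m d)))) (⊴-+ʳ (go d) (v⊴v (m ℕ.+ d)))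

    E-block : ∀ m j → E (m ℕ.+ j) ⊴ (E m + ι j * v m)
    E-block m zero    = ⊴-resp (reflexive (≡.cong E (≡.sym (ℕₚ.+-identityʳ m)))) (sym (trans (+-congˡ (zeroˡ _)) (+-identityʳ _))) (E⊴E m)
    E-block m (suc j) = ⊴-resp (reflexive (≡.cong E (≡.sym (ℕₚ.+-suc m j))))
      (solve 3 (λ e i v → e :+ i :* v :+ v := e :+ (con 1 :+ i) :* v) refl _ _ _)
      (+-⊴ (E-block m j) (v-anti (ℕₚ.m≤m+n m j)))

    -- Each dyadic block has 2^k terms of size at most 2^(-k) and so adds at most 1.
    E-dyadic : ∀ k → E (dyadic k) ⊴ ι (suc k)
    E-dyadic zero    = ⊴-respʳ (sym (+-identityʳ 1#)) 1⊴1
    E-dyadic (suc k) = ⊴-trans (E-block (dyadic k) (suc (dyadic k)))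
      (⊴-resp (+-congˡ (sym (ι*v≈1 (dyadic k)))) (+-comm _ _) (+-⊴ (E-dyadic k) 1⊴1))

    c-≼ : ∀ n → c n ≼ 1# ·geo E n
    c-≼ zero    = const-1-≼ 1⊴1
    c-≼ (suc n) t = ⊴-resp (+-congˡ (-‿cong (sym (X-const-⊛ (v n) (c n) t)))) (sym (*-identityˡ _))
      (⊴-trans (+-⊴ (c≼ t) (neg-⊴ (shift-≼ (λ t → *-⊴ (v⊴v n) (c≼ t)) t))) (geo-step (E⊴E n) (v⊴v n) t))
      where
      c≼ : ∀ t → c n t ⊴ (E n ^ t)
      c≼ t = ⊴-respʳ (*-identityˡ _) (c-≼ n t)

    b-suc : ∀ j t → b (suc j) t ≈ v j * (ι j * b j t + shift (b j) t)
    b-suc j t = trans (const-⊛ (v j) _ t) (*-congˡ (trans (⊛-distribʳ (b j) (KC.ι j) X t)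
      (+-cong (trans (⊛-cong (ι-const j) K.refl t) (const-⊛ (ι j) (b j) t)) (X-⊛ (b j) t))))

    -- `b (suc j)` is X/(j+1) times the product of 1 + X/i over 1 ≤ i ≤ j, and the first factor is
    -- the gain. `b 0` has none, so `κ` is estimated at `suc j` only.
    b-≼ : ∀ j → b (suc j) ≼ v j ·geo E j
    b-≼ zero    t = ⊴-respˡ (sym (b-suc 0 t)) (*-⊴ (v⊴v 0) (first t))
      where
      first : ∀ t → (0# * const 1# t + shift (const 1#) t) ⊴ (1# ^ t)
      first zero          = ⊴-respˡ (sym (trans (+-identityʳ _) (zeroˡ _))) (0⊴ 1⊴1)
      first (suc zero)    = ⊴-resp (sym (trans (+-congʳ (zeroˡ _)) (+-identityˡ _))) (sym (*-identityˡ _)) 1⊴1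
      first (suc (suc t)) = ⊴-respˡ (sym (trans (+-congʳ (zeroˡ _)) (+-identityˡ _))) (0⊴ (^-⊴ (suc (suc t)) 1⊴1))
    b-≼ (suc j) t = ⊴-respˡ (sym (b-suc (suc j) t)) (*-⊴ (v⊴v (suc j))
      (⊴-trans (+-⊴ (*-⊴ (ι⊴ι (suc j)) (b-≼ j t)) (shift-≼ (b-≼ j) t))
        (⊴-respˡ (+-congʳ (sym (trans (sym (*-assoc _ _ _)) (trans (*-congʳ (ι*v≈1 j)) (*-identityˡ _)))))
          (geo-step (E⊴E j) (v⊴v j) t))))

    p⊛-≼ : ∀ n {w f} → w ⊴ w → f ≼ w ·geo E n → pᴷ n ⊛ f ≼ w ·geo E (suc n)
    p⊛-≼ n {w} {f} w⊴w f≼ t = ⊴-trans (⊛-≼ {pᴷ n} {1# ·geo v n} {f} {w ·geo E n} (λ t → ⊴-respʳ (sym (*-identityˡ _)) (^-⊴ t (v⊴v n))) f≼ t)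
      (⊴-trans (·geo-⊛ 1⊴1 w⊴w (v⊴v n) (E⊴E n) t)
        (·geo-≼ (⊴-respˡ (sym (*-identityˡ _)) w⊴w) (⊴-respˡ (+-comm _ _) (E⊴E (suc n))) t))

    -- Each summation costs one factor `E`, whence the power; each factor `p` adds its `v` to the
    -- base of the geometric majorant.
    O-≼ : ∀ ks n → O ks n ≼ (E n ^ length ks) ·geo E n
    H-≼ : ∀ k ks n → H k ks n ≼ (v n * E n ^ length ks) ·geo E (suc n)

    O-≼ []       n       t = ⊴-respˡ (sym (O-[] n t)) (const-1-≼ (E⊴E n) t)
    O-≼ (k ∷ ks) zero    t = ⊴-respˡ (sym (O-zero k ks t)) (0⊴ (*-⊴ (^-⊴ (suc (length ks)) 1⊴1) (^-⊴ t 1⊴1)))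
    O-≼ (k ∷ ks) (suc n) t = ⊴-respˡ (sym (O-suc k ks n t))
      (⊴-trans (+-⊴ (p⊛-≼ n (^-⊴ (suc (length ks)) (E⊴E n)) (O-≼ (k ∷ ks) n) t) (H-≼ k ks n t))
        (⊴-respˡ (solve 4 (λ e x w y → (e :+ w) :* x :* y := e :* x :* y :+ w :* x :* y) refl _ _ _ _)
          (*-⊴ (*-⊴ (E⊴E (suc n)) (^-⊴ (length ks) (⊴-+ʳ (E⊴E n) (v⊴v n)))) (^-⊴ t (E⊴E (suc n))))))
    H-≼ k ks n t = ⊴-resp (sym (trans (H-rec k ks n t) (const-^-⊛ (v n) (suc k) (pᴷ n ⊛ O ks n) t))) (sym (*-assoc _ _ _))
      (*-⊴ (⊴-respʳ (trans (*-congˡ (1^ k)) (*-identityʳ _)) (*-⊴ (v⊴v n) (^-⊴ k (v⊴1 n))))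
           (p⊛-≼ n (^-⊴ (length ks) (E⊴E n)) (O-≼ ks n) t))
      where
      1^ : ∀ k → 1# ^ k ≈ 1#
      1^ zero    = refl
      1^ (suc k) = trans (*-identityˡ _) (1^ k)

    -- The sum of `v i` over j ≤ i ≤ j + m, built in step with `κ m (suc j)` from the gains of the
    -- entries of `b` in it.
    s : ℕ → ℕ → Carrier
    s zero    j = v j
    s (suc m) j = s m (suc j) + v j

    s⊴s : ∀ m j → s m j ⊴ s m j
    s⊴s zero    j = v⊴v j
    s⊴s (suc m) j = +-⊴ (s⊴s m (suc j)) (v⊴v j)

    s-E : ∀ m j → s m j + E j ≈ E (suc m ℕ.+ j)
    s-E zero    j = +-comm _ _
    s-E (suc m) j = trans (trans (+-assoc _ _ _) (+-congˡ (+-comm _ _)))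
      (trans (s-E m (suc j)) (reflexive (≡.cong (E ∘ suc) (ℕₚ.+-suc m j))))

    s⊴E : ∀ m j → s m j ⊴ E (suc m ℕ.+ j)
    s⊴E m j = ⊴-respʳ (s-E m j) (⊴-+ʳ (s⊴s m j) (E⊴E j))

    -- Partial fractions: 1/(ab) = (1/a + 1/b)/(a + b).
    v*v : ∀ i j → v i * v j ≈ v (suc i ℕ.+ j) * (v i + v j)
    v*v i j = sym (begin
      w * (v i + v j)
        ≈⟨ *-congˡ (+-cong (trans (sym (*-identityʳ _)) (*-congˡ (sym (ι*v≈1 j)))) (trans (sym (*-identityʳ _)) (*-congˡ (sym (ι*v≈1 i))))) ⟩
      w * (v i * (ι (suc j) * v j) + v j * (ι (suc i) * v i))
        ≈⟨ solve 5 (λ w p q m n → w :* (p :* (n :* q) :+ q :* (m :* p)) := (m :+ n) :* w :* (p :* q)) refl _ _ _ _ _ ⟩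
      (ι (suc i) + ι (suc j)) * w * (v i * v j)
        ≈⟨ *-congʳ (*-congʳ (trans (sym (ι-+ (suc i) (suc j))) (reflexive (≡.cong ι (ℕₚ.+-suc (suc i) j))))) ⟩
      ι (suc (suc i ℕ.+ j)) * w * (v i * v j)
        ≈⟨ trans (*-congʳ (ι*v≈1 (suc i ℕ.+ j))) (*-identityˡ _) ⟩
      v i * v j ∎)
      where
      open import Relation.Binary.Reasoning.Setoid setoid
      w = v (suc i ℕ.+ j)

    -- The source of the decay. The summand `v (j + i)` of `s m j` is paired with `v (m - i)`, which
    -- is at least `v m`; all the partial fractions then share the denominator m + j + 2.
    v*s : ∀ m j → (v m * s m j) ⊴ (v (suc m ℕ.+ j) * (E (suc m) + s m j))
    v*s zero    j = ⊴-respˡ (sym (v*v 0 j)) (*-⊴ (v⊴v (suc j)) (+-⊴ (⊴-+ˡ (v⊴v 0) 1⊴1) (v⊴v j)))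
    v*s (suc m) j = ⊴-resp (sym (distribˡ _ _ _))
      (solve 5 (λ w e s p q → w :* (e :+ s) :+ w :* (p :+ q) := w :* (e :+ p :+ (s :+ q))) refl _ _ _ _ _)
      (+-⊴ (⊴-trans (*-⊴ (v-anti (ℕₚ.n≤1+n m)) (s⊴s m (suc j)))
                    (⊴-respʳ (*-congʳ (reflexive (≡.cong (v ∘ suc) (ℕₚ.+-suc m j)))) (v*s m (suc j))))
           (⊴-respˡ (sym (v*v (suc m) j)) (*-⊴ (v⊴v _) (+-⊴ (v⊴v (suc m)) (v⊴v j)))))

    c*b-≼ : ∀ M i j → i ℕ.≤ M → j ℕ.≤ M → c i ⊛ b (suc j) ≼ v j ·geo (E M + E M)
    c*b-≼ M i j i≤M j≤M t = ⊴-trans (⊛-≼ {c i} {1# ·geo E i} {b (suc j)} {v j ·geo E j} (c-≼ i) (b-≼ j) t)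
      (⊴-trans (·geo-⊛ 1⊴1 (v⊴v j) (E⊴E i) (E⊴E j) t)
        (·geo-≼ (⊴-respˡ (sym (*-identityˡ _)) (v⊴v j)) (+-⊴ (E-mono i≤M) (E-mono j≤M)) t))

    κ-≼ : ∀ M m j → suc m ℕ.+ j ℕ.≤ M → κ m (suc j) ≼ s m j ·geo (E M + E M)
    κ-≼ M zero    j le t = c*b-≼ M 0 j z≤n (ℕₚ.≤-trans (ℕₚ.n≤1+n j) le) t
    κ-≼ M (suc m) j le t = ⊴-respʳ (sym (distribʳ _ _ _))
      (+-⊴ (κ-≼ M m (suc j) (ℕₚ.≤-trans (ℕₚ.≤-reflexive (≡.cong suc (ℕₚ.+-suc m j))) le) t)
           (c*b-≼ M (suc m) j (ℕₚ.≤-trans (ℕₚ.≤-trans (ℕₚ.n≤1+n _) (ℕₚ.m≤m+n (suc (suc m)) j)) le) (ℕₚ.≤-trans (ℕₚ.m≤n+m j _) le) t))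

    remainder : ℕ → List ℕ → ℕ → ℕ → Carrier
    remainder k ks t M = Σ< M (λ m → v m * (H k ks m ⊛ κ m (M ∸ m)) t)

    3E : ℕ → Carrier
    3E M = E M + (E M + E M)

    3E⊴3E : ∀ M → 3E M ⊴ 3E M
    3E⊴3E M = +-⊴ (E⊴E M) (+-⊴ (E⊴E M) (E⊴E M))

    -- Here M = m + j + 1, so `v*s` trades one `v m` and `s m j` for `v M` and a factor below
    -- `3E M`. The base of the t-th power collects one `E` from `H` and two from `c` and `b` inside
    -- `κ`; the other factors are enlarged to the same base.
    summand-⊴ : ∀ k ks t M m → m ℕ.< M →
      (v m * (H k ks m ⊛ κ m (M ∸ m)) t) ⊴ (v M * (3E M ^ (length ks ℕ.+ suc t)) * v m)
    summand-⊴ k ks t M m m<M with ℕₚ.m≤n⇒∃[o]m+o≡n m<M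
    ... | j , ≡.refl = ⊴-respˡ (*-congˡ (K.*-congˡ {H k ks m} (reflexive ∘ λ t → ≡.cong (λ i → κ m i t) (≡.sym M∸m)) t))
      (⊴-trans (*-⊴ (v⊴v m) (⊴-trans (⊛-≼ {H k ks m} {(v m * e ^ length ks) ·geo e} {κ m (suc j)} {s m j ·geo (e + e)}
                   (λ t → ⊴-trans (H-≼ k ks m t) (·geo-≼ (*-⊴ (v⊴v m) (^-⊴ (length ks) Em⊴)) (E-mono (ℕₚ.m≤m+n (suc m) j)) t))
                   (κ-≼ M m j ℕₚ.≤-refl) t)
                 (·geo-⊛ (*-⊴ (v⊴v m) (^-⊴ (length ks) (E⊴E M))) (s⊴s m j) (E⊴E M) (+-⊴ (E⊴E M) (E⊴E M)) t)))
      (⊴-resp (solve 5 (λ v₁ v₂ x s y → v₁ :* ((v₂ :* s) :* (x :* y)) := v₁ :* (v₂ :* x :* s :* y)) refl (v m) (v m) (e ^ length ks) (s m j) (3E M ^ t))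
        (trans (solve 5 (λ v₁ w d x y → v₁ :* (w :* d :* (x :* y)) := w :* (x :* (d :* y)) :* v₁) refl (v m) (v M) (3E M) (3E M ^ length ks) (3E M ^ t))
               (*-congʳ (*-congˡ (sym (^-homo-* (3E M) (length ks) (suc t))))))
        (*-⊴ (v⊴v m) (*-⊴ (⊴-trans (v*s m j) (*-⊴ (v⊴v M) (⊴-+ʳ₂ (+-⊴ (E-mono (ℕₚ.m≤m+n (suc m) j)) (s⊴E m j)))))
                          (*-⊴ (^-⊴ (length ks) (⊴-+ʳ (E⊴E M) (+-⊴ (E⊴E M) (E⊴E M)))) (^-⊴ t (3E⊴3E M)))))))
      where
      open Exp semiring using (^-homo-*)
      e = E M
      M∸m : M ∸ m ≡ suc j
      M∸m = ≡.trans (≡.cong (_∸ m) (≡.sym (ℕₚ.+-suc m j))) (ℕₚ.m+n∸m≡n m (suc j))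
      Em⊴ : E m ⊴ e
      Em⊴ = E-mono (ℕₚ.≤-trans (ℕₚ.n≤1+n m) (ℕₚ.m≤m+n (suc m) j))
      ⊴-+ʳ₂ : ∀ {x} → x ⊴ (e + e) → x ⊴ 3E M
      ⊴-+ʳ₂ x⊴ = ⊴-+ˡ x⊴ (E⊴E M)

    Σ<v⊴E : ∀ n → Σ< n v ⊴ E n
    Σ<v⊴E zero    = 0⊴ 1⊴1
    Σ<v⊴E (suc n) = ⊴-respˡ (sym (Σ<-last n v)) (+-⊴ (Σ<v⊴E n) (v⊴v n))

    -- The additional power bounds the harmonic sum of the `v m` still left in the summands.
    remainder-⊴ : ∀ k ks t M → remainder k ks t M ⊴ (v M * 3E M ^ (length ks ℕ.+ suc (suc t)))
    remainder-⊴ k ks t M = ⊴-trans (Σ<-⊴ M (summand-⊴ k ks t M))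
      (⊴-resp (sym (*-Σ< M _ v))
        (trans (trans (*-assoc _ _ _) (*-congˡ (*-comm _ _))) (*-congˡ (reflexive (≡.cong (3E M ^_) (≡.sym (ℕₚ.+-suc (length ks) (suc t)))))))
        (*-⊴ (*-⊴ (v⊴v M) (^-⊴ (length ks ℕ.+ suc t) (3E⊴3E M))) (⊴-trans (Σ<v⊴E M) (⊴-+ʳ (E⊴E M) (+-⊴ (E⊴E M) (E⊴E M))))))

    -- For M in the i-th dyadic block, `v M` is at most 2^(-i) and `E M` at most i + 2, so
    -- `2^-dominates` applies with the constant C + 1, the denominator of `v C`.
    remainder→0 : ∀ k ks t C → ∃ λ M₀ → ∀ M → M₀ ℕ.≤ M → remainder k ks t M ⊴ v C
    remainder→0 k ks t C with 2^-dominates (length ks ℕ.+ suc (suc t)) (suc C)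
    ... | k₀ , bound = dyadic k₀ , go
      where
      d = length ks ℕ.+ suc (suc t)
      go : ∀ M → dyadic k₀ ℕ.≤ M → remainder k ks t M ⊴ v C
      go M M₀≤M with dyadic-bracket M
      ... | i , lo , hi = ⊴-trans (remainder-⊴ k ks t M)
        (⊴-trans (*-⊴ (v-anti lo) (^-⊴ d 3E⊴ι))
          (⊴-respˡ (trans (*-congʳ (ι-^ (3 ℕ.* (2 ℕ.+ i)) d)) (*-comm _ _))
            (v-bound C ((3 ℕ.* (2 ℕ.+ i)) ℕ.^ d) (dyadic i) (ℕₚ.≤-trans (bound i k₀≤i) (ℕₚ.≤-reflexive (≡.sym (suc-dyadic i)))))))
        where
        k₀≤i : k₀ ℕ.≤ i
        k₀≤i with ℕₚ.≤-total k₀ i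
        ... | inj₁ le = le
        ... | inj₂ i≤k₀ with ℕₚ.m≤n⇒m<n∨m≡n i≤k₀
        ...   | inj₁ i<k₀   = ⊥-elim (ℕₚ.<-irrefl ≡.refl (ℕₚ.≤-trans hi (ℕₚ.≤-trans (dyadic-mono i<k₀) M₀≤M)))
        ...   | inj₂ ≡.refl = ℕₚ.≤-refl
        E⊴ι : E M ⊴ ι (2 ℕ.+ i)
        E⊴ι = ⊴-trans (E-mono (ℕₚ.<⇒≤ hi)) (E-dyadic (suc i))
        3E⊴ι : 3E M ⊴ ι (3 ℕ.* (2 ℕ.+ i))
        3E⊴ι = ⊴-respʳ (trans (solve 1 (λ x → x :+ (x :+ x) := (con 1 :+ (con 1 :+ (con 1 :+ con 0))) :* x) refl _) (sym (ι-* 3 (2 ℕ.+ i)))) (+-⊴ E⊴ι (+-⊴ E⊴ι E⊴ι))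

-- Specialisation to the rational numbers.

open CauchyProduct ℚₚ.+-*-commutativeRing using (Σ<; Σ<-cong; ι; _⊛_)
open IndexSums ℚₚ.+-*-commutativeRing
open Exp (CommutativeRing.semiring ℚₚ.+-*-commutativeRing) using (_^_)

v : ℕ → ℚ
v n = (+ 1) ℚ./ suc n

toℚᵘ-v : ∀ n → toℚᵘ (v n) ℚᵘ.≃ mkℚᵘ (+ 1) n
toℚᵘ-v n = ℚₚ.toℚᵘ-fromℚᵘ (mkℚᵘ (+ 1) n)

toℚᵘ-ι : ∀ n → toℚᵘ (ι n) ℚᵘ.≃ mkℚᵘ (+ n) 0
toℚᵘ-ι zero    = ℚᵘₚ.≃-refl
toℚᵘ-ι (suc n) = ℚᵘₚ.≃-trans (ℚₚ.toℚᵘ-homo-+ 1ℚ (ι n)) (ℚᵘₚ.≃-trans (ℚᵘₚ.+-congʳ (toℚᵘ 1ℚ) (toℚᵘ-ι n))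
  (*≡* (≡.cong (ℤ._* + 1) (≡.cong (λ z → + 1 ℤ.+ z) (ℤₚ.*-identityʳ (+ n))))))

ι*v≡1 : ∀ n → ι (suc n) ℚ.* v n ≡ 1ℚ
ι*v≡1 n = ℚₚ.toℚᵘ-injective (ℚᵘₚ.≃-trans (ℚₚ.toℚᵘ-homo-* (ι (suc n)) (v n))
  (ℚᵘₚ.≃-trans (ℚᵘₚ.*-cong (toℚᵘ-ι (suc n)) (toℚᵘ-v n))
    (*≡* (≡.trans (ℤₚ.*-identityʳ (+ suc n ℤ.* + 1)) (≡.trans (ℤₚ.*-comm (+ suc n) (+ 1)) (≡.cong (λ d → + 1 ℤ.* + suc d) (≡.sym (ℕₚ.+-identityʳ n))))))))

v≥0 : ∀ n → 0ℚ ℚ.≤ v n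
v≥0 n = ℚₚ.nonNegative⁻¹ (v n) {{ℚₚ.normalize-nonNeg 1 (suc n)}}

v-archimedean : ∀ ε → 0ℚ < ε → ∃ λ C → v C < ε
v-archimedean ε 0<ε = go ε (ℚ.positive 0<ε)
  where
  go : ∀ ε → ℚ.Positive ε → ∃ λ C → v C < ε
  -- `mkℚ` stores the denominator minus one, so the chain is ε ≥ 1/(d+1) > 1/(d+2) = `v (suc d)`.
  go (mkℚ +[1+ n ] d _) _ = suc d , ℚₚ.toℚᵘ-cancel-< (ℚᵘₚ.<-respˡ-≃ (ℚᵘₚ.≃-sym (toℚᵘ-v (suc d)))
    (*<* (ℤₚ.<-≤-trans (ℤₚ.*-monoˡ-<-pos (+ 1) (ℤ.+<+ (ℕₚ.n<1+n (suc d)))) (ℤₚ.*-monoʳ-≤-nonNeg (+ suc (suc d)) (ℤ.+≤+ (s≤s (z≤n {n})))))))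

infix 4 _⊴_
_⊴_ : ℚ → ℚ → Set
x ⊴ y = ∣ x ∣ ℚ.≤ y

⊴⇒≥0 : ∀ {x y} → x ⊴ y → 0ℚ ℚ.≤ y
⊴⇒≥0 {x} x⊴y = ℚₚ.≤-trans (ℚₚ.0≤∣p∣ x) x⊴y

≥0⇒⊴ : ∀ {x} → 0ℚ ℚ.≤ x → x ⊴ x
≥0⇒⊴ 0≤x = ℚₚ.≤-reflexive (ℚₚ.0≤p⇒∣p∣≡p 0≤x)

⊴-trans : ∀ {x y z} → x ⊴ y → y ⊴ z → x ⊴ z
⊴-trans {x} {y} {z} x⊴y y⊴z = ℚₚ.≤-trans x⊴y (ℚₚ.≤-trans (ℚₚ.≤-reflexive (≡.sym (ℚₚ.0≤p⇒∣p∣≡p (⊴⇒≥0 {x} {y} x⊴y)))) y⊴z)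

+-⊴ : ∀ {x x′ y y′} → x ⊴ y → x′ ⊴ y′ → (x ℚ.+ x′) ⊴ (y ℚ.+ y′)
+-⊴ {x} {x′} p q = ℚₚ.≤-trans (ℚₚ.∣p+q∣≤∣p∣+∣q∣ x x′) (ℚₚ.+-mono-≤ p q)

*-⊴ : ∀ {x x′ y y′} → x ⊴ y → x′ ⊴ y′ → (x ℚ.* x′) ⊴ (y ℚ.* y′)
*-⊴ {x} {x′} {y} {y′} p q = ℚₚ.≤-trans (ℚₚ.≤-reflexive (ℚₚ.∣p*q∣≡∣p∣*∣q∣ x x′))
  (ℚₚ.≤-trans (ℚₚ.*-monoʳ-≤-nonNeg ∣ x′ ∣ {{ℚₚ.∣-∣-nonNeg x′}} p)
              (ℚₚ.*-monoˡ-≤-nonNeg y {{ℚ.nonNegative (⊴⇒≥0 {x} {y} p)}} q))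

neg-⊴ : ∀ {x y} → x ⊴ y → (ℚ.- x) ⊴ y
neg-⊴ {x} p = ℚₚ.≤-trans (ℚₚ.≤-reflexive (ℚₚ.∣-p∣≡∣p∣ x)) p

open GeneratingSeries.Zeta ℚₚ.+-*-commutativeRing v ι*v≡1 using (H; κ; ζ; ζ⁺; rhs≈lhs+remainder)

remainder : ℕ → List ℕ → ℕ → ℕ → ℚ
remainder k ks t M = Σ< M (λ m → v m ℚ.* (H k ks m ⊛ κ m (M ∸ m)) t)

remainder→0 : ∀ k ks t C → ∃ λ M₀ → ∀ M → M₀ ≤ M → remainder k ks t M ⊴ v C
remainder→0 = Majorants.remainder→0 ℚₚ.+-*-commutativeRing _⊴_
  (λ { {x} {x′} {y} {y′} ≡.refl ≡.refl p → p })
  (λ {x} {y} {z} → ⊴-trans {x} {y} {z})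
  (λ {x} {x′} {y} {y′} → +-⊴ {x} {x′} {y} {y′})
  (λ {x} {x′} {y} {y′} → *-⊴ {x} {x′} {y} {y′})
  (λ {x} {y} → neg-⊴ {x} {y})
  ℚₚ.≤-refl ℚₚ.≤-refl (λ {x} → ⊴⇒≥0 {x} {x})
  v ι*v≡1 (λ n → ≥0⇒⊴ (v≥0 n))

-- Identification with the truncated sums of the statement, and the limit.

sumℚ-sumOver : ∀ {B : Set} (F : B → ℚ) xs → sumℚ (map F xs) ≡ sumOver F xs
sumℚ-sumOver F xs = ≡.trans (go (map F xs)) (≡.sym (sumOver-foldr F xs))
  where
  go : ∀ ys → sumℚ ys ≡ foldr ℚ._+_ 0ℚ ys
  go []       = ≡.refl
  go (y ∷ ys) = ≡.cong (y ℚ.+_) (go ys)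

invPow-^ : ∀ n k → invPow n k ≡ v n ^ k
invPow-^ n zero    = ≡.refl
invPow-^ n (suc k) = ≡.cong (v n ℚ.*_) (invPow-^ n k)

zetaTr-ζ : ∀ n ks → zetaTr (suc n) ks ≡ ζ n ks
zetaTr-ζ n []       = ≡.refl
zetaTr-ζ n (k ∷ ks) = ≡.trans (sumℚ-sumOver _ (upTo n)) (≡.trans (sumOver-upTo _ n)
  (Σ<-cong n (λ l → ≡.cong₂ ℚ._*_ (invPow-^ l k) (zetaTr-ζ l ks))))

zetaPlusTr-ζ⁺ : ∀ n ks → zetaPlusTr (suc n) ks ≡ ζ⁺ n ks
zetaPlusTr-ζ⁺ n ks = zetaTr-ζ n (incrFirst ks)

lhsTr-lhsSum : ∀ ks t M → lhsTr ks t (suc M) ≡ lhsSum ks (ζ⁺ M) t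
lhsTr-lhsSum ks t M = ≡.trans (sumℚ-sumOver _ (posComps (length ks) (length ks ℕ.+ t)))
  (sumOver-cong (λ ms → ≡.trans (sumℚ-sumOver _ (blocks ks ms)) (sumOver-cong (zetaPlusTr-ζ⁺ M) (blocks ks ms))) _)

rhsTr-rhsSum : ∀ k ks t M → rhsTr (k ∷ ks) t (suc M) ≡ rhsSum k ks (ζ⁺ M) t
rhsTr-rhsSum k ks t M = ≡.trans (sumℚ-sumOver (λ l → layerTr l (t ∸ l)) (upTo (suc t)))
  (≡.trans (sumOver-upTo (λ l → layerTr l (t ∸ l)) (suc t))
  (≡.trans (Σ<-antidiagonal t layerTr) (antidiagonal-cong t layerTr-raise)))
  where
  indexTr : ℕ → List ℕ → ℚ
  indexTr l idx = sumℚ (map (λ e → zetaPlusTr (suc M) (zipWith ℕ._+_ idx e)) (weakComps (length idx) l))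
  indexTr-raise : ∀ l idx → indexTr l idx ≡ raise idx (ζ⁺ M) l
  indexTr-raise l idx = ≡.trans (sumℚ-sumOver _ (weakComps (length idx) l))
    (sumOver-cong (λ e → zetaPlusTr-ζ⁺ M (zipWith ℕ._+_ idx e)) (weakComps (length idx) l))
  layerTr : ℕ → ℕ → ℚ
  layerTr l u = sumℚ (map (λ ms → indexTr l (interleave (k ∷ ks) ms)) (weakComps (length ks) u))
  layerTr-raise : ∀ l u → layerTr l u ≡ sumOver (λ ms → raise (k ∷ onesThen ks ms) (ζ⁺ M) l) (weakComps (length ks) u)
  layerTr-raise l u = ≡.trans (sumℚ-sumOver (λ ms → indexTr l (interleave (k ∷ ks) ms)) (weakComps (length ks) u))
    (sumOver-cong (λ ms → ≡.trans (indexTr-raise l (interleave (k ∷ ks) ms))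
                                  (≡.cong (λ i → raise i (ζ⁺ M) l) (interleave-∷ k ks ms))) (weakComps (length ks) u))

rhsTr-lhsTr : ∀ k ks t M → let ks⁺ = suc k ∷ map suc ks in
  rhsTr ks⁺ t (suc M) ≡ lhsTr ks⁺ t (suc M) ℚ.+ remainder k ks t M
rhsTr-lhsTr k ks t M = ≡.trans (rhsTr-rhsSum (suc k) (map suc ks) t M)
  (≡.trans (rhs≈lhs+remainder k ks M t)
           (≡.cong (ℚ._+ remainder k ks t M) (≡.sym (lhsTr-lhsSum (suc k ∷ map suc ks) t M))))

positive-predecessors : ∀ {r} (k : Vec ℕ r) → All (1 ≤_) k → ∃ λ ks → toList k ≡ map suc ks
positive-predecessors Vec.[]           All.[]          = [] , ≡.refl
positive-predecessors (suc k Vec.∷ ks) (_ All.∷ ks≥1) with positive-predecessors ks ks≥1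
... | js , eq = k ∷ js , ≡.cong (suc k ∷_) eq

x-[x+y] : ∀ x y → x - (x ℚ.+ y) ≡ ℚ.- y
x-[x+y] x y = ≡.trans (≡.cong (x ℚ.+_) (ℚₚ.neg-distrib-+ x y)) (≡.trans (≡.sym (ℚₚ.+-assoc x (ℚ.- x) (ℚ.- y)))
  (≡.trans (≡.cong (ℚ._+ (ℚ.- y)) (ℚₚ.+-inverseʳ x)) (ℚₚ.+-identityˡ (ℚ.- y))))

lhsTr-near-rhsTr : ∀ k ks t ε → 0ℚ < ε → let ks⁺ = suc k ∷ map suc ks in
  ∃ λ N₀ → (N : ℕ) → N₀ ≤ N → ∣ lhsTr ks⁺ t N - rhsTr ks⁺ t N ∣ < ε
-- Truncation at N = M + 1 admits the variables n₁ ≤ M, so the bound for M ≥ M₀ covers N ≥ M₀ + 1.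
lhsTr-near-rhsTr k ks t ε 0<ε = suc M₀ , near
  where
  C = proj₁ (v-archimedean ε 0<ε)
  M₀ = proj₁ (remainder→0 k ks t C)
  near : ∀ N → suc M₀ ≤ N → ∣ lhsTr (suc k ∷ map suc ks) t N - rhsTr (suc k ∷ map suc ks) t N ∣ < ε
  near (suc M) (s≤s M₀≤M) = ℚₚ.≤-<-trans
    (ℚₚ.≤-trans (ℚₚ.≤-reflexive (≡.trans
      (≡.cong (λ z → ∣ lhsTr (suc k ∷ map suc ks) t (suc M) - z ∣) (rhsTr-lhsTr k ks t M))
      (≡.trans (≡.cong ∣_∣ (x-[x+y] (lhsTr (suc k ∷ map suc ks) t (suc M)) (remainder k ks t M))) (ℚₚ.∣-p∣≡∣p∣ (remainder k ks t M)))))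
      (proj₂ (remainder→0 k ks t C) M M₀≤M))
    (proj₂ (v-archimedean ε 0<ε))

theorem1p1 : (r : ℕ) → 1 ≤ r → (k : Vec ℕ r) → All (1 ≤_) k → (t : ℕ) →
    (ε : ℚ) → 0ℚ < ε →
    ∃ λ N₀ → (N : ℕ) → N₀ ≤ N →
    ∣ lhsTr (toList k) t N - rhsTr (toList k) t N ∣ < ε
theorem1p1 (suc r) _ (suc k Vec.∷ k′) (_ All.∷ k′≥1) t ε 0<ε =
  ≡.subst (λ l → ∃ λ N₀ → (N : ℕ) → N₀ ≤ N → ∣ lhsTr (suc k ∷ l) t N - rhsTr (suc k ∷ l) t N ∣ < ε)
    (≡.sym (proj₂ (positive-predecessors k′ k′≥1)))
    (lhsTr-near-rhsTr k (proj₁ (positive-predecessors k′ k′≥1)) t ε 0<ε)
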